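{- There is an absolute constant $c>0$ such that the following holds. Let $G$ be a finite abelian group of order $n$. Then there exists a subset $B\subset G$ with $B=-B$ and $0\notin B$ such that the Cayley graph $G_B$ contains neither a complete subgraph nor an independent set on more than $c\left(\omega^3(n)\log\omega(n)+\log n\log\log n\right)$ vertices.
   Context: For a finite abelian group $G$ and $B\subset G$ with $B=-B$, $0\notin B$, the Cayley graph $G_B$ has vertex set $G$, and $i,j\in G$ are joined by an edge iff $i-j\in B$. An independent set is a set of vertices no two of which are joined by an edge. $\omega(n)$ denotes the number of distinct prime divisors of $n$.
   Formalization: Each log is read as 1 + ⌊log₂⌋, since for n = 2 the stated bound is not positive (a single vertex violates it) and for n = 1 it is undefined; for n ≥ 3 the two forms agree up to the absolute constant c. -}

module Defs where

open import Data.Nat using (ℕ; suc; _+_; _*_; _^_; _≤_)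
open import Data.Nat.Divisibility using (_∣?_)
open import Data.Nat.Primality using (prime?)
open import Data.Nat.Logarithm using (⌊log₂_⌋)
open import Data.List using (List; length; filter; upTo)
open import Data.Fin using (Fin)
open import Data.Fin.Subset using (Subset; _∈_; _∉_; ∣_∣)
open import Relation.Nullary using (¬_)
open import Relation.Nullary.Decidable using (_×-dec_)
open import Relation.Binary.PropositionalEquality using (_≡_)
open import Algebra.Structures using (IsAbelianGroup)

-- ω(n): number of distinct primes p dividing n (primes are ≤ n when n ≥ 1)
ω : ℕ → ℕ
ω n = length (filter (λ p → prime? p ×-dec (p ∣? n)) (upTo (suc n)))

-- Logarithm convention: L x = 1 + ⌊log₂ x⌋, which is ≍ max(1, log x) for x ≥ 1.
L : ℕ → ℕ
L x = suc ⌊log₂ x ⌋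

-- A finite abelian group of order n, realised on the carrier Fin n
-- (every finite abelian group of order n is isomorphic to one of these).
record FinAbGroup (n : ℕ) : Set where
  field
    _∙_ : Fin n → Fin n → Fin n
    ε   : Fin n
    _⁻¹ : Fin n → Fin n
    isAbelianGroup : IsAbelianGroup _≡_ _∙_ ε _⁻¹

module _ {n : ℕ} (G : FinAbGroup n) where
  open FinAbGroup G

  Symmetric : Subset n → Set
  Symmetric B = ∀ x → x ∈ B → (x ⁻¹) ∈ B

  ZeroFree : Subset n → Set
  ZeroFree B = ε ∉ B

  IsClique : Subset n → Subset n → Set
  IsClique B S = ∀ i j → i ∈ S → j ∈ S → ¬ (i ≡ j) → (i ∙ (j ⁻¹)) ∈ B

  IsIndependent : Subset n → Subset n → Set
  IsIndependent B S = ∀ i j → i ∈ S → j ∈ S → ¬ (i ≡ j) → (i ∙ (j ⁻¹)) ∉ B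

bound : ℕ → ℕ → ℕ
bound c n = c * ((ω n ^ 3) * L (ω n) + L n * L (L n))

{-# OPTIONS --safe #-}
module Submission where

-- In fact O(log n log log n) suffices.  Choose B at random, with x and x⁻¹
-- decided together.  A k-set A is a clique or independent only if the choice is
-- constant on the differences D A, so by the union bound it suffices that every
-- A with k = C log n log log n contains (or is) a set U that can be described
-- with far fewer than ∣ D U ∣ bits.
--
-- Let ∣ D A ∣ = K k.  Build T ⊆ A as follows.  By pigeonhole some difference d
-- satisfies v = d t for at least ∣ T ∣ / 2K pairs v ∈ A ─ T, t ∈ T; after one such
-- v is named (log n bits), the others have the form a b c⁻¹ with a, b, c already
-- known (O(log log n) bits each).  So 2K such v double T, and O(K log log n) of
-- them bring ∣ T ∣ to s ≈ 128 log n.  From then on add, at log n bits each,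
-- elements v ∈ A for which more than half of the differences v t⁻¹ are new; each
-- pays for itself.  When none is left, A lies in the set X T of the v with at
-- least half of the v t⁻¹ in D T, and counting pairs gives ∣ X T ∣ ≤ 2 ∣ D T ∣.
-- Hence ∣ D T ∣ ≥ k / 2, and U = T works if K ≤ 64.  If K > 64, then U = A works:
-- it is a k-subset of X T, a set of size at most 2 K k, and choosing it costs
-- at most K k / 32 + 7 k + 1 further bits.

open import Defs
open import Algebra.Bundles using (AbelianGroup; Group)
import Algebra.Properties.AbelianGroup
open import Data.Bool using (Bool; true; false; _∧_)
open import Data.Empty using (⊥-elim) renaming (⊥ to Empty)
open import Data.Fin using (Fin; zero; suc; toℕ)
open import Data.Fin.Permutation using (permutation)
open import Data.Fin.Properties using (any?; toℕ-injective) renaming (_≟_ to _≟ᶠ_)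
open import Data.Fin.Subset using (Subset; inside; outside; ∣_∣; _∈_; _∉_; _⊆_; _∩_; _∪_; _─_; ⁅_⁆; ⊥; ⊤)
open import Data.Fin.Subset.Properties
open import Data.List using (List; []; _∷_; _++_; length; map; filter; concatMap; upTo)
open import Data.List.Membership.Propositional using () renaming (_∈_ to _∈ₗ_)
open import Data.List.Membership.Propositional.Properties using (∈-map⁺; ∈-concatMap⁺; ∈-filter⁺; ∈-++⁺ˡ; ∈-++⁺ʳ; ∈-upTo⁺)
open import Data.List.Properties using (length-map; length-++; length-filter; length-upTo; map-++)
open import Data.List.Relation.Unary.All using (All; []; _∷_)
open import Data.List.Relation.Unary.All.Properties using (all-filter)
open import Data.List.Relation.Unary.Any as Any using () renaming (here to hereₗ; there to thereₗ)
open import Data.Nat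
open import Data.Nat.DivMod using (_/_; _%_; m≡m%n+[m/n]*n; m%n<n; m/n*n≤m; /-monoˡ-≤; m*n/n≡m)
open import Data.Nat.ListAction using () renaming (sum to sumList)
open import Data.Nat.ListAction.Properties using (sum-++)
open import Data.Nat.Logarithm using (⌊log₂_⌋; ⌊log₂⌋-mono-≤; ⌊log₂[2^n]⌋≡n; ⌊log₂[2*b]⌋≡1+⌊log₂b⌋)
open import Data.Nat.Properties
open import Data.Nat.Tactic.RingSolver using (solve-∀)
open import Data.Product using (Σ; Σ-syntax; ∃-syntax; _×_; _,_; proj₁; proj₂)
open import Data.Sum using (_⊎_; inj₁; inj₂; [_,_]′)
open import Data.Unit using (tt)
open import Data.Vec using ([]; _∷_; lookup; tabulate; here; there; tail)
open import Data.Vec.Properties using ([]=⇒lookup; lookup⇒[]=; lookup∘tabulate; lookup-zipWith)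
open import Function using (_∘_)
open import Level using (0ℓ)
open import Relation.Binary.PropositionalEquality
open import Relation.Nullary using (¬_; Dec; yes; no; does; contradiction)
open import Relation.Nullary.Decidable using (_×-dec_; ¬?; dec-true; decidable-stable)
open import Relation.Unary using (Pred; Decidable)
open import Algebra.Properties.Semiring.Sum +-*-semiring using (sum-syntax; ∑-comm; sum-permute; sum-cong-≗; *-distribˡ-sum; *-distribʳ-sum)

private
  variable
    n : ℕ

-- Counting in subsets of Fin n

∑-mono-≤ : {f g : Fin n → ℕ} → (∀ i → f i ≤ g i) → ∑[ i < n ] f i ≤ ∑[ i < n ] g i
∑-mono-≤ {zero}  f≤g = z≤n
∑-mono-≤ {suc n} f≤g = +-mono-≤ (f≤g zero) (∑-mono-≤ (f≤g ∘ suc))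

argmax : Fin n → (f : Fin n → ℕ) → ∃[ i ] (∀ j → f j ≤ f i)
argmax {suc zero}    _ f = zero , λ { zero → ≤-refl }
argmax {suc (suc n)} _ f with argmax zero (f ∘ suc)
... | i , max with ≤-total (f zero) (f (suc i))
...   | inj₁ f₀≤ = suc i , λ { zero → f₀≤ ; (suc j) → max j }
...   | inj₂ ≤f₀ = zero , λ { zero → ≤-refl ; (suc j) → ≤-trans (max j) ≤f₀ }

⟦_⟧ : Bool → ℕ
⟦ true  ⟧ = 1
⟦ false ⟧ = 0

χ : Subset n → Fin n → ℕ
χ p x = ⟦ lookup p x ⟧

χ-∈ : {p : Subset n} {x : Fin n} → x ∈ p → χ p x ≡ 1
χ-∈ x∈p = cong ⟦_⟧ ([]=⇒lookup x∈p)

χ-∉ : {p : Subset n} {x : Fin n} → x ∉ p → χ p x ≡ 0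
χ-∉ {p = p} {x} x∉p with lookup p x in eq
... | true  = contradiction (lookup⇒[]= x p eq) x∉p
... | false = refl

χ-∩ : (p q : Subset n) (x : Fin n) → χ (p ∩ q) x ≡ χ p x * χ q x
χ-∩ p q x rewrite lookup-zipWith _∧_ x p q with lookup p x
... | true  = sym (+-identityʳ _)
... | false = refl

∣p∣≡∑χ : (p : Subset n) → ∣ p ∣ ≡ ∑[ x < n ] χ p x
∣p∣≡∑χ []            = refl
∣p∣≡∑χ (inside  ∷ p) = cong suc (∣p∣≡∑χ p)
∣p∣≡∑χ (outside ∷ p) = ∣p∣≡∑χ p

∣p∩q∣+∣q─p∣≡∣q∣ : (p q : Subset n) → ∣ p ∩ q ∣ + ∣ q ─ p ∣ ≡ ∣ q ∣
∣p∩q∣+∣q─p∣≡∣q∣ [] [] = refl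
∣p∩q∣+∣q─p∣≡∣q∣ (inside  ∷ p) (inside  ∷ q) = cong suc (∣p∩q∣+∣q─p∣≡∣q∣ p q)
∣p∩q∣+∣q─p∣≡∣q∣ (inside  ∷ p) (outside ∷ q) = ∣p∩q∣+∣q─p∣≡∣q∣ p q
∣p∩q∣+∣q─p∣≡∣q∣ (outside ∷ p) (inside  ∷ q) = trans (+-suc _ _) (cong suc (∣p∩q∣+∣q─p∣≡∣q∣ p q))
∣p∩q∣+∣q─p∣≡∣q∣ (outside ∷ p) (outside ∷ q) = ∣p∩q∣+∣q─p∣≡∣q∣ p q

∣p∪q∣+∣p∩q∣≡∣p∣+∣q∣ : (p q : Subset n) → ∣ p ∪ q ∣ + ∣ p ∩ q ∣ ≡ ∣ p ∣ + ∣ q ∣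
∣p∪q∣+∣p∩q∣≡∣p∣+∣q∣ [] [] = refl
∣p∪q∣+∣p∩q∣≡∣p∣+∣q∣ (inside  ∷ p) (inside  ∷ q) =
  cong suc (trans (+-suc _ _) (trans (cong suc (∣p∪q∣+∣p∩q∣≡∣p∣+∣q∣ p q)) (sym (+-suc _ _))))
∣p∪q∣+∣p∩q∣≡∣p∣+∣q∣ (inside  ∷ p) (outside ∷ q) = cong suc (∣p∪q∣+∣p∩q∣≡∣p∣+∣q∣ p q)
∣p∪q∣+∣p∩q∣≡∣p∣+∣q∣ (outside ∷ p) (inside  ∷ q) =
  trans (cong suc (∣p∪q∣+∣p∩q∣≡∣p∣+∣q∣ p q)) (sym (+-suc _ _))
∣p∪q∣+∣p∩q∣≡∣p∣+∣q∣ (outside ∷ p) (outside ∷ q) = ∣p∪q∣+∣p∩q∣≡∣p∣+∣q∣ p q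

∣p∪q∣≤∣p∣+∣q∣ : (p q : Subset n) → ∣ p ∪ q ∣ ≤ ∣ p ∣ + ∣ q ∣
∣p∪q∣≤∣p∣+∣q∣ p q = ≤-trans (m≤m+n _ _) (≤-reflexive (∣p∪q∣+∣p∩q∣≡∣p∣+∣q∣ p q))

disjoint⇒∣p∪q∣≡∣p∣+∣q∣ : (p q : Subset n) → (∀ {x} → x ∈ p → x ∉ q) → ∣ p ∪ q ∣ ≡ ∣ p ∣ + ∣ q ∣
disjoint⇒∣p∪q∣≡∣p∣+∣q∣ {n} p q dis = trans (sym (+-identityʳ _))
  (trans (cong (∣ p ∪ q ∣ +_) (sym (n≤0⇒n≡0 empty))) (∣p∪q∣+∣p∩q∣≡∣p∣+∣q∣ p q))
  where
  empty : ∣ p ∩ q ∣ ≤ 0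
  empty = ≤-trans (p⊆q⇒∣p∣≤∣q∣ {q = ⊥} (λ x∈ → let (x∈p , x∈q) = x∈p∩q⁻ p q x∈ in ⊥-elim (dis x∈p x∈q)))
                  (≤-reflexive (∣⊥∣≡0 n))

x∈p─q⇒x∈p×x∉q : (p q : Subset n) {x : Fin n} → x ∈ p ─ q → x ∈ p × x ∉ q
x∈p─q⇒x∈p×x∉q (inside ∷ p) (outside ∷ q) {zero} here = here , λ ()
x∈p─q⇒x∈p×x∉q (outside ∷ p) (inside ∷ q) {zero} ()
x∈p─q⇒x∈p×x∉q (outside ∷ p) (outside ∷ q) {zero} ()
x∈p─q⇒x∈p×x∉q (_ ∷ p) (_ ∷ q) {suc x} (there x∈) =
  let (x∈p , x∉q) = x∈p─q⇒x∈p×x∉q p q x∈ in there x∈p , λ { (there x∈q) → x∉q x∈q }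

∣p∪⁅x⁆∣≡1+∣p∣ : (p : Subset n) {x : Fin n} → x ∉ p → ∣ p ∪ ⁅ x ⁆ ∣ ≡ suc ∣ p ∣
∣p∪⁅x⁆∣≡1+∣p∣ p {x} x∉p = trans
  (disjoint⇒∣p∪q∣≡∣p∣+∣q∣ p ⁅ x ⁆ (λ y∈p y∈⁅x⁆ → x∉p (subst (_∈ p) (x∈⁅y⁆⇒x≡y x y∈⁅x⁆) y∈p)))
  (trans (cong (∣ p ∣ +_) (∣⁅x⁆∣≡1 x)) (+-comm ∣ p ∣ 1))

∪⁅⁆-⊆ : {p q : Subset n} {x : Fin n} → p ⊆ q → x ∈ q → p ∪ ⁅ x ⁆ ⊆ q
∪⁅⁆-⊆ {p = p} {q} {x} p⊆q x∈q y∈ with x∈p∪q⁻ p ⁅ x ⁆ y∈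
... | inj₁ y∈p = p⊆q y∈p
... | inj₂ y∈x = subst (_∈ q) (sym (x∈⁅y⁆⇒x≡y x y∈x)) x∈q

∣p∣<∣q∣⇒∃∈q─p : (p q : Subset n) → ∣ p ∣ < ∣ q ∣ → ∃[ x ] (x ∈ q × x ∉ p)
∣p∣<∣q∣⇒∃∈q─p p q p<q with any? (λ x → (x ∈? q) ×-dec ¬? (x ∈? p))
... | yes found = found
... | no  none  = contradiction (p⊆q⇒∣p∣≤∣q∣ {p = q} {q = p} sub) (<⇒≱ p<q)
  where
  sub : q ⊆ p
  sub {x} x∈q = decidable-stable (x ∈? p) (λ x∉p → none (x , x∈q , x∉p))

subset-of-size : (p : Subset n) (m : ℕ) → m ≤ ∣ p ∣ → ∃[ q ] (q ⊆ p × ∣ q ∣ ≡ m)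
subset-of-size {n} p zero    _   = ⊥ , (λ x∈⊥ → contradiction x∈⊥ ∉⊥) , ∣⊥∣≡0 n
subset-of-size p (suc m) m<p with subset-of-size p m (<⇒≤ m<p)
... | q , q⊆p , refl with ∣p∣<∣q∣⇒∃∈q─p q p m<p
...   | x , x∈p , x∉q = q ∪ ⁅ x ⁆ , ∪⁅⁆-⊆ q⊆p x∈p , ∣p∪⁅x⁆∣≡1+∣p∣ q x∉q

abstract
  ⁅_∣⁆ : {P : Pred (Fin n) 0ℓ} → Decidable P → Subset n
  ⁅ P? ∣⁆ = tabulate (does ∘ P?)

  ∈-comprehension⁺ : {P : Pred (Fin n) 0ℓ} (P? : Decidable P) {x : Fin n} → P x → x ∈ ⁅ P? ∣⁆
  ∈-comprehension⁺ P? {x} px = lookup⇒[]= x _ (trans (lookup∘tabulate _ x) (dec-true (P? x) px))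

  ∈-comprehension⁻ : {P : Pred (Fin n) 0ℓ} (P? : Decidable P) {x : Fin n} → x ∈ ⁅ P? ∣⁆ → P x
  ∈-comprehension⁻ P? {x} x∈ with P? x | trans (sym (lookup∘tabulate (does ∘ P?) x)) ([]=⇒lookup x∈)
  ... | yes px | _ = px

  preimage : (Fin n → Fin n) → Subset n → Subset n
  preimage f p = tabulate (lookup p ∘ f)

  ∈-preimage⁺ : (f : Fin n → Fin n) (p : Subset n) {x : Fin n} → f x ∈ p → x ∈ preimage f p
  ∈-preimage⁺ f p {x} fx∈p = lookup⇒[]= x _ (trans (lookup∘tabulate _ x) ([]=⇒lookup fx∈p))

  ∈-preimage⁻ : (f : Fin n → Fin n) (p : Subset n) {x : Fin n} → x ∈ preimage f p → f x ∈ p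
  ∈-preimage⁻ f p {x} x∈ = lookup⇒[]= (f x) p (trans (sym (lookup∘tabulate _ x)) ([]=⇒lookup x∈))

  χ-preimage : (f : Fin n → Fin n) (p : Subset n) (x : Fin n) → χ (preimage f p) x ≡ χ p (f x)
  χ-preimage f p x = cong ⟦_⟧ (lookup∘tabulate (lookup p ∘ f) x)

∑χ-bijection : (p : Subset n) (f g : Fin n → Fin n) → (∀ x → f (g x) ≡ x) → (∀ x → g (f x) ≡ x) →
               ∑[ x < n ] χ p (f x) ≡ ∣ p ∣
∑χ-bijection p f g fg gf = trans (sym (sum-permute (χ p) (permutation f g fg gf))) (sym (∣p∣≡∑χ p))

∣preimage∣ : (p : Subset n) (f g : Fin n → Fin n) → (∀ x → f (g x) ≡ x) → (∀ x → g (f x) ≡ x) →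
             ∣ preimage f p ∣ ≡ ∣ p ∣
∣preimage∣ p f g fg gf = trans (∣p∣≡∑χ (preimage f p))
  (trans (sum-cong-≗ (χ-preimage f p)) (∑χ-bijection p f g fg gf))

-- Double counting: for fixed `x` the map sending `y` to `f y x` is a bijection with inverse `g`, so
-- every pair of an element of `p` and one of `q` is counted for exactly one `y`.
∑∣p∩preimage∣ : (p q : Subset n) (f g : Fin n → Fin n → Fin n) →
                (∀ x y → f (g y x) x ≡ y) → (∀ x y → g (f y x) x ≡ y) →
                ∑[ y < n ] ∣ p ∩ preimage (f y) q ∣ ≡ ∣ p ∣ * ∣ q ∣
∑∣p∩preimage∣ {n} p q f g fg gf = begin
  ∑[ y < n ] ∣ p ∩ preimage (f y) q ∣        ≡⟨ sum-cong-≗ (λ y → trans (∣p∣≡∑χ (p ∩ preimage (f y) q)) (sum-cong-≗ (λ x → trans (χ-∩ p _ x) (cong (χ p x *_) (χ-preimage (f y) q x))))) ⟩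
  ∑[ y < n ] ∑[ x < n ] (χ p x * χ q (f y x))  ≡⟨ ∑-comm {n} {n} (λ y x → χ p x * χ q (f y x)) ⟩
  ∑[ x < n ] ∑[ y < n ] (χ p x * χ q (f y x))  ≡⟨ sum-cong-≗ (λ x → trans (sym (*-distribˡ-sum (χ p x) (λ y → χ q (f y x)))) (cong (χ p x *_) (∑χ-bijection q (λ y → f y x) (λ y → g y x) (fg x) (gf x)))) ⟩
  ∑[ x < n ] (χ p x * ∣ q ∣)                   ≡⟨ *-distribʳ-sum ∣ q ∣ (χ p) ⟨
  (∑[ x < n ] χ p x) * ∣ q ∣                 ≡⟨ cong (_* ∣ q ∣) (∣p∣≡∑χ p) ⟨
  ∣ p ∣ * ∣ q ∣                              ∎
  where open ≡-Reasoning

∑≤M*∣p∣ : (p : Subset n) (h : Fin n → ℕ) (M : ℕ) → (∀ x → h x ≤ M) → (∀ x → x ∉ p → h x ≡ 0) →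
          ∑[ x < n ] h x ≤ M * ∣ p ∣
∑≤M*∣p∣ {n} p h M h≤M h-supp = begin
  ∑[ x < n ] h x         ≤⟨ ∑-mono-≤ pointwise ⟩
  ∑[ x < n ] (M * χ p x)   ≡⟨ *-distribˡ-sum M (χ p) ⟨
  M * ∑[ x < n ] χ p x   ≡⟨ cong (M *_) (∣p∣≡∑χ p) ⟨
  M * ∣ p ∣              ∎
  where
  open ≤-Reasoning
  pointwise : ∀ x → h x ≤ M * χ p x
  pointwise x with x ∈? p
  ... | yes x∈p rewrite χ-∈ x∈p | *-identityʳ M = h≤M x
  ... | no  x∉p rewrite h-supp x x∉p = z≤n

∣p∣*M≤∑ : (p : Subset n) (h : Fin n → ℕ) (M : ℕ) → (∀ x → x ∈ p → M ≤ h x) → ∣ p ∣ * M ≤ ∑[ x < n ] h x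
∣p∣*M≤∑ {n} p h M M≤h = begin
  ∣ p ∣ * M                ≡⟨ cong (_* M) (∣p∣≡∑χ p) ⟩
  (∑[ x < n ] χ p x) * M   ≡⟨ *-distribʳ-sum M (χ p) ⟩
  ∑[ x < n ] (χ p x * M)     ≤⟨ ∑-mono-≤ pointwise ⟩
  ∑[ x < n ] h x           ∎
  where
  open ≤-Reasoning
  pointwise : ∀ x → χ p x * M ≤ h x
  pointwise x with x ∈? p
  ... | yes x∈p rewrite χ-∈ x∈p | +-identityʳ M = M≤h x x∈p
  ... | no  x∉p rewrite χ-∉ x∉p = z≤n

-- The union bound

-- The number of subsets that contain `p`, which is also the number of those disjoint from `p`;
-- divided by `2 ^ n` it is the probability of either event for a random subset.
weight : Subset n → ℕ
weight []            = 1
weight (inside  ∷ p) = weight p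
weight (outside ∷ p) = 2 * weight p

weight*2^∣p∣≡2^n : (p : Subset n) → weight p * 2 ^ ∣ p ∣ ≡ 2 ^ n
weight*2^∣p∣≡2^n []            = refl
weight*2^∣p∣≡2^n {suc n} (inside  ∷ p) =
  trans (rearrange (weight p) (2 ^ ∣ p ∣)) (cong (2 *_) (weight*2^∣p∣≡2^n p))
  where
  rearrange : ∀ a b → a * (2 * b) ≡ 2 * (a * b)
  rearrange = solve-∀
weight*2^∣p∣≡2^n (outside ∷ p) =
  trans (*-assoc 2 (weight p) _) (cong (2 *_) (weight*2^∣p∣≡2^n p))

totalWeight : List (Subset n) → ℕ
totalWeight = sumList ∘ map weight

totalWeight-++ : (ps qs : List (Subset n)) → totalWeight (ps ++ qs) ≡ totalWeight ps + totalWeight qs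
totalWeight-++ ps qs = trans (cong sumList (map-++ weight ps qs)) (sum-++ (map weight ps) (map weight qs))

-- Once the first coordinate of `b` is fixed, either all constraints survive through their tails or
-- only those that avoid this coordinate: a set with `inside` in front can neither lie in
-- `outside ∷ b` nor be disjoint from `inside ∷ b`.
outsideTails : List (Subset (suc n)) → List (Subset n)
outsideTails []                   = []
outsideTails ((inside  ∷ p) ∷ ps) = outsideTails ps
outsideTails ((outside ∷ p) ∷ ps) = p ∷ outsideTails ps

∈-outsideTails : {p : Subset n} {ps : List (Subset (suc n))} → (outside ∷ p) ∈ₗ ps → p ∈ₗ outsideTails ps
∈-outsideTails (hereₗ refl) = hereₗ refl
∈-outsideTails {ps = (inside  ∷ _) ∷ _} (thereₗ p∈) = ∈-outsideTails p∈
∈-outsideTails {ps = (outside ∷ _) ∷ _} (thereₗ p∈) = thereₗ (∈-outsideTails p∈)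

-- A set that contains the first coordinate counts in one branch only; any other counts in both,
-- each time with half its weight.
totalWeight-split : (ps : List (Subset (suc n))) →
                    totalWeight (map tail ps) + totalWeight (outsideTails ps) ≡ totalWeight ps
totalWeight-split [] = refl
totalWeight-split ((inside ∷ p) ∷ ps) =
  trans (+-assoc (weight p) _ _) (cong (weight p +_) (totalWeight-split ps))
totalWeight-split ((outside ∷ p) ∷ ps) =
  trans (rearrange (weight p) (totalWeight (map tail ps)) (totalWeight (outsideTails ps)))
        (cong (2 * weight p +_) (totalWeight-split ps))
  where
  rearrange : ∀ a b c → (a + b) + (a + c) ≡ 2 * a + (b + c)
  rearrange = solve-∀

Avoids : List (Subset n) → List (Subset n) → Subset n → Set
Avoids P Q b = (∀ p → p ∈ₗ P → ¬ (p ⊆ b)) × (∀ q → q ∈ₗ Q → ¬ (∀ x → x ∈ q → x ∉ b))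

-- Conditional expectations: the weights of the two ways of fixing the first
-- coordinate add up to the total weight, so one of the two keeps the invariant.
avoid : (P Q : List (Subset n)) → totalWeight P + totalWeight Q < 2 ^ n → ∃[ b ] Avoids P Q b
avoid {zero} []       []       _ = [] , (λ _ ()) , (λ _ ())
avoid {zero} ([] ∷ P) Q        (s≤s ())
avoid {zero} []       ([] ∷ Q) (s≤s ())
avoid {suc n} P Q small with totalWeight (map tail P) + totalWeight (outsideTails Q) <? 2 ^ n
... | yes small₁ with avoid (map tail P) (outsideTails Q) small₁
...   | b , notP , notQ = inside ∷ b , notP′ , notQ′
  where
  notP′ : ∀ p → p ∈ₗ P → ¬ (p ⊆ (inside ∷ b))
  notP′ (_ ∷ p) p∈P p⊆ = notP p (∈-map⁺ tail p∈P) (λ x∈p → drop-there (p⊆ (there x∈p)))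
  notQ′ : ∀ q → q ∈ₗ Q → ¬ (∀ x → x ∈ q → x ∉ (inside ∷ b))
  notQ′ (inside  ∷ q) q∈Q q∌ = q∌ zero here here
  notQ′ (outside ∷ q) q∈Q q∌ = notQ q (∈-outsideTails q∈Q) (λ x x∈q x∈b → q∌ (suc x) (there x∈q) (there x∈b))
avoid {suc n} P Q small | no big with avoid (outsideTails P) (map tail Q) small₂
  where
  rearrange : ∀ a b c d → (a + d) + (b + c) ≡ (a + b) + (c + d)
  rearrange = solve-∀
  small₂ : totalWeight (outsideTails P) + totalWeight (map tail Q) < 2 ^ n
  small₂ = +-cancelˡ-< (2 ^ n) _ _ (begin-strict
    2 ^ n + (totalWeight (outsideTails P) + totalWeight (map tail Q))
      ≤⟨ +-monoˡ-≤ _ (≮⇒≥ big) ⟩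
    (totalWeight (map tail P) + totalWeight (outsideTails Q)) + (totalWeight (outsideTails P) + totalWeight (map tail Q))
      ≡⟨ rearrange (totalWeight (map tail P)) _ _ _ ⟩
    (totalWeight (map tail P) + totalWeight (outsideTails P)) + (totalWeight (map tail Q) + totalWeight (outsideTails Q))
      ≡⟨ cong₂ _+_ (totalWeight-split P) (totalWeight-split Q) ⟩
    totalWeight P + totalWeight Q
      <⟨ small ⟩
    2 * 2 ^ n
      ≡⟨ cong (2 ^ n +_) (+-identityʳ (2 ^ n)) ⟩
    2 ^ n + 2 ^ n ∎)
    where open ≤-Reasoning
...   | b , notP , notQ = outside ∷ b , notP′ , notQ′
  where
  notP′ : ∀ p → p ∈ₗ P → ¬ (p ⊆ (outside ∷ b))
  notP′ (inside  ∷ p) p∈P p⊆ with p⊆ here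
  ... | ()
  notP′ (outside ∷ p) p∈P p⊆ = notP p (∈-outsideTails p∈P) (λ x∈p → drop-there (p⊆ (there x∈p)))
  notQ′ : ∀ q → q ∈ₗ Q → ¬ (∀ x → x ∈ q → x ∉ (outside ∷ b))
  notQ′ (_ ∷ q) q∈Q q∌ = notQ q (∈-map⁺ tail q∈Q) (λ x x∈q x∈b → q∌ (suc x) (there x∈q) (there x∈b))

totalWeight-bound : (c : ℕ) (ps : List (Subset n)) → All (λ p → c ≤ ∣ p ∣) ps →
                    totalWeight ps * 2 ^ c ≤ length ps * 2 ^ n
totalWeight-bound c []       []             = z≤n
totalWeight-bound {n} c (p ∷ ps) (c≤∣p∣ ∷ rest) = begin
  (weight p + totalWeight ps) * 2 ^ c          ≡⟨ *-distribʳ-+ (2 ^ c) (weight p) _ ⟩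
  weight p * 2 ^ c + totalWeight ps * 2 ^ c    ≤⟨ +-mono-≤ (*-monoʳ-≤ (weight p) (^-monoʳ-≤ 2 c≤∣p∣)) (totalWeight-bound c ps rest) ⟩
  weight p * 2 ^ ∣ p ∣ + length ps * 2 ^ n     ≡⟨ cong (_+ length ps * 2 ^ n) (weight*2^∣p∣≡2^n p) ⟩
  2 ^ n + length ps * 2 ^ n                    ∎
  where open ≤-Reasoning

module _ {I : Set} (F : I → List (Subset n)) (c : I → ℕ) (F-small : ∀ i → length (F i) ≤ 2 ^ c i)
         (is : List I) (m : ℕ) (is-small : length is ≤ 2 ^ m) where

  heavy : I → List (Subset n)
  heavy i = filter (λ p → c i + (m + 2) ≤? ∣ p ∣) (F i)

  private
    heavy-weight : ∀ i → totalWeight (heavy i) * 2 ^ (m + 2) ≤ 2 ^ n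
    heavy-weight i = *-cancelˡ-≤ (2 ^ c i) {{m^n≢0 2 (c i)}} (begin
      2 ^ c i * (totalWeight (heavy i) * 2 ^ (m + 2))  ≡⟨ rearrange (2 ^ c i) (totalWeight (heavy i)) (2 ^ (m + 2)) ⟩
      totalWeight (heavy i) * (2 ^ c i * 2 ^ (m + 2))  ≡⟨ cong (totalWeight (heavy i) *_) (^-distribˡ-+-* 2 (c i) (m + 2)) ⟨
      totalWeight (heavy i) * 2 ^ (c i + (m + 2))      ≤⟨ totalWeight-bound (c i + (m + 2)) (heavy i) (all-filter _ (F i)) ⟩
      length (heavy i) * 2 ^ n                         ≤⟨ *-monoˡ-≤ (2 ^ n) (≤-trans (length-filter _ (F i)) (F-small i)) ⟩
      2 ^ c i * 2 ^ n                                  ∎)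
      where
      open ≤-Reasoning
      rearrange : ∀ a b c → a * (b * c) ≡ b * (a * c)
      rearrange = solve-∀

    all-weight : ∀ js → totalWeight (concatMap heavy js) * 2 ^ (m + 2) ≤ length js * 2 ^ n
    all-weight []       = z≤n
    all-weight (j ∷ js) rewrite totalWeight-++ (heavy j) (concatMap heavy js)
                              | *-distribʳ-+ (2 ^ (m + 2)) (totalWeight (heavy j)) (totalWeight (concatMap heavy js)) =
      +-mono-≤ (heavy-weight j) (all-weight js)

    4*W≤2^n : 4 * totalWeight (concatMap heavy is) ≤ 2 ^ n
    4*W≤2^n = *-cancelˡ-≤ (2 ^ m) {{m^n≢0 2 m}} (begin
      2 ^ m * (4 * W)  ≡⟨ rearrange (2 ^ m) W ⟩
      W * (2 ^ m * 4)  ≡⟨ cong (W *_) (^-distribˡ-+-* 2 m 2) ⟨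
      W * 2 ^ (m + 2)  ≤⟨ all-weight is ⟩
      length is * 2 ^ n ≤⟨ *-monoˡ-≤ (2 ^ n) is-small ⟩
      2 ^ m * 2 ^ n    ∎)
      where
      open ≤-Reasoning
      W = totalWeight (concatMap heavy is)
      rearrange : ∀ a b → a * (4 * b) ≡ b * (a * 4)
      rearrange = solve-∀

    4x≤y⇒x+x<y : ∀ x {y} → 0 < y → 4 * x ≤ y → x + x < y
    4x≤y⇒x+x<y zero    0<y _   = 0<y
    4x≤y⇒x+x<y (suc x) _ 4x≤y  = <-≤-trans (≤-trans (m≤m+n _ (suc (2 * x))) (≤-reflexive (rearrange x))) 4x≤y
      where
      rearrange : ∀ x → suc (suc x + suc x) + suc (2 * x) ≡ 4 * suc x
      rearrange = solve-∀

  -- The heavy members of one family weigh at most `2 ^ n / 2 ^ (m + 2)`, so all of them together at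
  -- most `2 ^ n / 4`. They are used twice, as sets not to be contained in `b` and as sets not to be
  -- disjoint from it, and the sum stays below `2 ^ n`.
  nonconstant : ∃[ b ] (∀ i → i ∈ₗ is → ∀ p → p ∈ₗ F i → c i + (m + 2) ≤ ∣ p ∣ →
                        ¬ (p ⊆ b) × ¬ (∀ x → x ∈ p → x ∉ b))
  nonconstant with avoid (concatMap heavy is) (concatMap heavy is)
                         (4x≤y⇒x+x<y (totalWeight (concatMap heavy is)) (m^n>0 2 n) 4*W≤2^n)
  ... | b , notP , notQ = b , λ i i∈ p p∈ big →
    let p∈′ = ∈-concatMap⁺ heavy (Any.map (λ { refl → ∈-filter⁺ _ p∈ big }) i∈)
    in notP p p∈′ , notQ p p∈′

-- Upper bounds for counts, by lists that contain every object with a property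

Few : {A : Set} → ℕ → Pred A 0ℓ → Set
Few {A} N P = Σ[ xs ∈ List A ] (length xs ≤ N × (∀ a → P a → a ∈ₗ xs))

private
  variable
    A B : Set
    P Q : Pred A 0ℓ

Few-⊆ : ∀ {M N} → M ≤ N → (∀ a → Q a → P a) → Few M P → Few N Q
Few-⊆ M≤N Q⊆P (xs , len , complete) = xs , ≤-trans len M≤N , λ a → complete a ∘ Q⊆P a

Few-∅ : (∀ a → ¬ P a) → ∀ {N} → Few N P
Few-∅ ¬P = [] , z≤n , λ a pa → contradiction pa (¬P a)

Few-⊎ : ∀ {M N} → Few M P → Few N Q → Few (M + N) (λ a → P a ⊎ Q a)
Few-⊎ (xs , len , complete) (ys , len′ , complete′) =
  xs ++ ys , ≤-trans (≤-reflexive (length-++ xs)) (+-mono-≤ len len′) ,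
  λ { a (inj₁ pa) → ∈-++⁺ˡ (complete a pa) ; a (inj₂ qa) → ∈-++⁺ʳ xs (complete′ a qa) }

Few-map : (f : A → B) {P : Pred A 0ℓ} → ∀ {N} → Few N P → Few N (λ b → ∃[ a ] (P a × b ≡ f a))
Few-map f (xs , len , complete) =
  map f xs , ≤-trans (≤-reflexive (length-map f xs)) len , λ { _ (a , pa , refl) → ∈-map⁺ f (complete a pa) }

length-concatMap-≤ : (f : A → List B) (N : ℕ) → (∀ a → length (f a) ≤ N) →
                     ∀ xs → length (concatMap f xs) ≤ length xs * N
length-concatMap-≤ f N f≤N []       = z≤n
length-concatMap-≤ f N f≤N (x ∷ xs) =
  ≤-trans (≤-reflexive (length-++ (f x))) (+-mono-≤ (f≤N x) (length-concatMap-≤ f N f≤N xs))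

-- Numbers of successive choices multiply. The bound `N` has to hold for every `a`, which is why
-- some of the predicates used as `Q` carry a size condition on `a` that makes them empty when `a`
-- is too large.
Few-bind : {P : Pred A 0ℓ} {Q : A → Pred B 0ℓ} → ∀ {M N} → Few M P → (∀ a → Few N (Q a)) →
           Few (M * N) (λ b → ∃[ a ] (P a × Q a b))
Few-bind {N = N} (xs , len , complete) next =
  concatMap (proj₁ ∘ next) xs ,
  ≤-trans (length-concatMap-≤ _ N (proj₁ ∘ proj₂ ∘ next) xs) (*-monoˡ-≤ N len) ,
  λ { b (a , pa , qab) → ∈-concatMap⁺ (proj₁ ∘ next) (Any.map (λ { refl → proj₂ (proj₂ (next a)) b qab }) (complete a pa)) }

Few-∈ : (p : Subset n) → Few ∣ p ∣ (_∈ p)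
Few-∈ []            = [] , z≤n , λ ()
Few-∈ (inside  ∷ p) with Few-∈ p
... | xs , len , complete = zero ∷ map suc xs , s≤s (≤-trans (≤-reflexive (length-map suc xs)) len) ,
  λ { zero _ → hereₗ refl ; (suc x) (there x∈p) → thereₗ (∈-map⁺ suc (complete x x∈p)) }
Few-∈ (outside ∷ p) with Few-∈ p
... | xs , len , complete = map suc xs , ≤-trans (≤-reflexive (length-map suc xs)) len ,
  λ { (suc x) (there x∈p) → ∈-map⁺ suc (complete x x∈p) }

-- Counting the subsets of a given size

sizedSubsets : (p : Subset n) (k : ℕ) → List (Subset n)
sizedSubsets []            zero    = [] ∷ []
sizedSubsets []            (suc k) = []
sizedSubsets (outside ∷ p) k       = map (outside ∷_) (sizedSubsets p k)
sizedSubsets (inside  ∷ p) zero    = map (outside ∷_) (sizedSubsets p zero)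
sizedSubsets (inside  ∷ p) (suc k) = map (outside ∷_) (sizedSubsets p (suc k)) ++ map (inside ∷_) (sizedSubsets p k)

∈-sizedSubsets : (p q : Subset n) → q ⊆ p → q ∈ₗ sizedSubsets p ∣ q ∣
∈-sizedSubsets [] [] _ = hereₗ refl
∈-sizedSubsets (outside ∷ p) (outside ∷ q) q⊆p = ∈-map⁺ _ (∈-sizedSubsets p q (drop-∷-⊆ q⊆p))
∈-sizedSubsets (outside ∷ p) (inside  ∷ q) q⊆p with q⊆p here
... | ()
∈-sizedSubsets (inside  ∷ p) (inside  ∷ q) q⊆p =
  ∈-++⁺ʳ (map (outside ∷_) (sizedSubsets p (suc ∣ q ∣))) (∈-map⁺ _ (∈-sizedSubsets p q (drop-∷-⊆ q⊆p)))
∈-sizedSubsets (inside  ∷ p) (outside ∷ q) q⊆p with ∣ q ∣ | ∈-sizedSubsets p q (drop-∷-⊆ q⊆p)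
... | zero  | q∈ = ∈-map⁺ _ q∈
... | suc _ | q∈ = ∈-++⁺ˡ (∈-map⁺ _ q∈)

-- The bound C(x,k) ≤ (1 + 1/q)^x q^k, without division.
length-sizedSubsets : (q : ℕ) (p : Subset n) (k : ℕ) →
                      length (sizedSubsets p k) * q ^ ∣ p ∣ ≤ suc q ^ ∣ p ∣ * q ^ k
length-sizedSubsets q []            zero    = ≤-refl
length-sizedSubsets q []            (suc k) = z≤n
length-sizedSubsets q (outside ∷ p) k       =
  ≤-trans (≤-reflexive (cong (_* q ^ ∣ p ∣) (length-map _ (sizedSubsets p k)))) (length-sizedSubsets q p k)
length-sizedSubsets q (inside  ∷ p) zero    = begin
  length (map (outside ∷_) (sizedSubsets p zero)) * (q * q ^ ∣ p ∣)
                      ≡⟨ cong (_* (q * q ^ ∣ p ∣)) (length-map _ (sizedSubsets p zero)) ⟩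
  l * (q * q ^ ∣ p ∣)  ≡⟨ rearrange l q (q ^ ∣ p ∣) ⟩
  q * (l * q ^ ∣ p ∣)  ≤⟨ *-mono-≤ (n≤1+n q) (length-sizedSubsets q p zero) ⟩
  suc q * (S * 1)     ≡⟨ *-assoc (suc q) S 1 ⟨
  suc q * S * 1       ∎
  where
  open ≤-Reasoning
  l = length (sizedSubsets p zero)
  S = suc q ^ ∣ p ∣
  rearrange : ∀ a b c → a * (b * c) ≡ b * (a * c)
  rearrange = solve-∀
length-sizedSubsets q (inside  ∷ p) (suc k) = begin
  length (map (outside ∷_) (sizedSubsets p (suc k)) ++ map (inside ∷_) (sizedSubsets p k)) * (q * q ^ ∣ p ∣)
    ≡⟨ cong (_* (q * q ^ ∣ p ∣)) (trans (length-++ (map (outside ∷_) (sizedSubsets p (suc k))))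
         (cong₂ _+_ (length-map _ (sizedSubsets p (suc k))) (length-map _ (sizedSubsets p k)))) ⟩
  (l₁ + l₀) * (q * q ^ ∣ p ∣)
    ≡⟨ rearrange₁ l₁ l₀ q (q ^ ∣ p ∣) ⟩
  q * (l₁ * q ^ ∣ p ∣ + l₀ * q ^ ∣ p ∣)
    ≤⟨ *-monoʳ-≤ q (+-mono-≤ (length-sizedSubsets q p (suc k)) (length-sizedSubsets q p k)) ⟩
  q * (S * (q * q ^ k) + S * q ^ k)
    ≡⟨ rearrange₂ q S (q ^ k) ⟩
  suc q * S * (q * q ^ k) ∎
  where
  open ≤-Reasoning
  l₁ = length (sizedSubsets p (suc k))
  l₀ = length (sizedSubsets p k)
  S = suc q ^ ∣ p ∣
  rearrange₁ : ∀ a b c d → (a + b) * (c * d) ≡ c * (a * d + b * d)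
  rearrange₁ = solve-∀
  rearrange₂ : ∀ q s t → q * (s * (q * t) + s * t) ≡ suc q * s * (q * t)
  rearrange₂ = solve-∀

-- Sets of differences

private
  1+a+b≤x : ∀ a b {x} → 4 ≤ x → 4 * a ≤ x → 4 * b ≤ x → 1 + (a + b) ≤ x
  1+a+b≤x a b {x} 4≤x 4a≤x 4b≤x = *-cancelˡ-≤ 4 (begin
    4 * (1 + (a + b))      ≡⟨ rearrange a b ⟩
    4 + (4 * a + 4 * b)    ≤⟨ +-mono-≤ 4≤x (+-mono-≤ 4a≤x 4b≤x) ⟩
    x + (x + x)            ≤⟨ +-monoʳ-≤ x (+-monoʳ-≤ x (m≤m+n x _)) ⟩
    4 * x                  ∎)
    where
    open ≤-Reasoning
    rearrange : ∀ a b → 4 * (1 + (a + b)) ≡ 4 + (4 * a + 4 * b)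
    rearrange = solve-∀

module Differences {n : ℕ} (G : FinAbGroup n) where
  open FinAbGroup G

  abelianGroup : AbelianGroup 0ℓ 0ℓ
  abelianGroup = record { isAbelianGroup = isAbelianGroup }

  open AbelianGroup abelianGroup using (assoc; group)
  open Group group using (_//_)
  open Algebra.Properties.AbelianGroup abelianGroup
    using (⁻¹-anti-homo-//; xyx⁻¹≈y; //-rightDividesˡ; //-rightDividesʳ)

  x∙[y//x]≡y : ∀ x y → x ∙ (y // x) ≡ y
  x∙[y//x]≡y x y = trans (sym (assoc x y (x ⁻¹))) (xyx⁻¹≈y x y)

  x//[x//y]≡y : ∀ x y → x // (x // y) ≡ y
  x//[x//y]≡y x y = trans (cong (x ∙_) (⁻¹-anti-homo-// x y)) (x∙[y//x]≡y x y)

  isDifference? : ∀ T (d : Fin n) → Dec (∃[ x ] (x ∈ T × d ∙ x ∈ T))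
  isDifference? T d = any? (λ x → (x ∈? T) ×-dec (d ∙ x ∈? T))

  D : Subset n → Subset n
  D T = ⁅ isDifference? T ∣⁆

  ∈-D⁺ : ∀ {T d x} → x ∈ T → d ∙ x ∈ T → d ∈ D T
  ∈-D⁺ {T} x∈T dx∈T = ∈-comprehension⁺ (isDifference? T) (_ , x∈T , dx∈T)

  ∈-D⁻ : ∀ {T d} → d ∈ D T → ∃[ x ] (x ∈ T × d ∙ x ∈ T)
  ∈-D⁻ {T} = ∈-comprehension⁻ (isDifference? T)

  D-mono : ∀ {S T} → S ⊆ T → D S ⊆ D T
  D-mono S⊆T d∈ = let (x , x∈ , dx∈) = ∈-D⁻ d∈ in ∈-D⁺ (S⊆T x∈) (S⊆T dx∈)

  -- The set of all `v // t` with `t ∈ T`: the map `v //_` is an involution, so preimage and image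
  -- under it agree.
  _⊖_ : Fin n → Subset n → Subset n
  v ⊖ T = preimage (v //_) T

  ∣v⊖T∣≡∣T∣ : ∀ v T → ∣ v ⊖ T ∣ ≡ ∣ T ∣
  ∣v⊖T∣≡∣T∣ v T = ∣preimage∣ T (v //_) (v //_) (x//[x//y]≡y v) (x//[x//y]≡y v)

  v⊖T⊆D : ∀ {A T v} → T ⊆ A → v ∈ A → v ⊖ T ⊆ D A
  v⊖T⊆D {A} {T} {v} T⊆A v∈A {d} d∈ =
    ∈-D⁺ (T⊆A (∈-preimage⁻ (v //_) T d∈)) (subst (_∈ A) (sym (x∙[y//x]≡y d v)) v∈A)

  -- The part of `A ─ T` covered by the translate of `T` by `d`.
  fibre : Subset n → Subset n → Fin n → Subset n
  fibre A T d = (A ─ T) ∩ preimage (_// d) T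

  ∈-fibre⁻ : ∀ A T {d u} → u ∈ fibre A T d → u ∈ A × u ∉ T × u // d ∈ T
  ∈-fibre⁻ A T {d} u∈ =
    let (u∈A─T , u∈pre) = x∈p∩q⁻ (A ─ T) _ u∈
        (u∈A , u∉T) = x∈p─q⇒x∈p×x∉q A T u∈A─T
    in u∈A , u∉T , ∈-preimage⁻ (_// d) T u∈pre

  -- Every pair of an element of `A ─ T` and one of `T` is counted by exactly one fibre, and fibres
  -- over `d ∉ D A` are empty, so the largest fibre is at least the average over `D A`.
  popular-difference : ∀ A T → T ⊆ A → ∃[ d ] ∣ A ─ T ∣ * ∣ T ∣ ≤ ∣ fibre A T d ∣ * ∣ D A ∣
  -- `ε` serves as a witness that `Fin n` is inhabited, so that a maximum exists.
  popular-difference A T T⊆A with argmax ε (λ d → ∣ fibre A T d ∣)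
  ... | d , max = d , (begin
    ∣ A ─ T ∣ * ∣ T ∣            ≡⟨ ∑∣p∩preimage∣ (A ─ T) T (λ d u → u // d) (λ y x → x // y) x//[x//y]≡y x//[x//y]≡y ⟨
    ∑[ d < n ] ∣ fibre A T d ∣   ≤⟨ ∑≤M*∣p∣ (D A) (λ d → ∣ fibre A T d ∣) _ max support ⟩
    ∣ fibre A T d ∣ * ∣ D A ∣    ∎)
    where
    open ≤-Reasoning
    support : ∀ d → d ∉ D A → ∣ fibre A T d ∣ ≡ 0
    support d d∉D = n≤0⇒n≡0 (≤-trans (p⊆q⇒∣p∣≤∣q∣ {q = ⊥} none) (≤-reflexive (∣⊥∣≡0 n)))
      where
      none : fibre A T d ⊆ ⊥
      none {u} u∈ = let (u∈A , _ , ud∈T) = ∈-fibre⁻ A T u∈ in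
        contradiction (∈-D⁺ (T⊆A ud∈T) (subst (_∈ A) (sym (x∙[y//x]≡y d u)) u∈A)) d∉D

  mostlyKnown? : ∀ T v → Dec (∣ T ∣ ≤ 2 * ∣ D T ∩ (v ⊖ T) ∣)
  mostlyKnown? T v = ∣ T ∣ ≤? 2 * ∣ D T ∩ (v ⊖ T) ∣

  X : Subset n → Subset n
  X T = ⁅ mostlyKnown? T ∣⁆

  -- Count the pairs of `v` and `d ∈ D T` with `v // d ∈ T`. There are `∣ D T ∣ * ∣ T ∣` of them,
  -- since `d` and `v // d` determine `v`, and each `v` in `X T` occurs in at least `∣ T ∣ / 2`.
  ∣X∣≤2∣D∣ : ∀ T → 0 < ∣ T ∣ → ∣ X T ∣ ≤ 2 * ∣ D T ∣
  ∣X∣≤2∣D∣ T 0<∣T∣ = *-cancelʳ-≤ _ _ ∣ T ∣ {{>-nonZero 0<∣T∣}} (begin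
    ∣ X T ∣ * ∣ T ∣                              ≤⟨ ∣p∣*M≤∑ (X T) (λ v → 2 * ∣ D T ∩ (v ⊖ T) ∣) ∣ T ∣ (λ _ → ∈-comprehension⁻ (mostlyKnown? T)) ⟩
    ∑[ v < n ] (2 * ∣ D T ∩ (v ⊖ T) ∣)           ≡⟨ *-distribˡ-sum {n} 2 (λ v → ∣ D T ∩ (v ⊖ T) ∣) ⟨
    2 * ∑[ v < n ] ∣ D T ∩ (v ⊖ T) ∣             ≡⟨ cong (2 *_) (∑∣p∩preimage∣ (D T) T _//_ _∙_ //-rightDividesʳ //-rightDividesˡ) ⟩
    2 * (∣ D T ∣ * ∣ T ∣)                        ≡⟨ *-assoc 2 ∣ D T ∣ ∣ T ∣ ⟨
    2 * ∣ D T ∣ * ∣ T ∣                          ∎)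
    where open ≤-Reasoning

  D-gain : ∀ T v → ∣ D T ∣ + ∣ (v ⊖ T) ─ D T ∣ ≤ ∣ D (T ∪ ⁅ v ⁆) ∣
  D-gain T v = ≤-trans (≤-reflexive (sym (disjoint⇒∣p∪q∣≡∣p∣+∣q∣ (D T) _ disjoint))) (p⊆q⇒∣p∣≤∣q∣ sub)
    where
    disjoint : ∀ {d} → d ∈ D T → d ∉ (v ⊖ T) ─ D T
    disjoint d∈D d∈N = proj₂ (x∈p─q⇒x∈p×x∉q (v ⊖ T) (D T) d∈N) d∈D
    sub : D T ∪ ((v ⊖ T) ─ D T) ⊆ D (T ∪ ⁅ v ⁆)
    sub d∈ with x∈p∪q⁻ (D T) _ d∈
    ... | inj₁ d∈D = D-mono (p⊆p∪q ⁅ v ⁆) d∈D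
    ... | inj₂ d∈N = v⊖T⊆D (p⊆p∪q ⁅ v ⁆) (q⊆p∪q T ⁅ v ⁆ (x∈⁅x⁆ v)) (proj₁ (x∈p─q⇒x∈p×x∉q (v ⊖ T) (D T) d∈N))

  Derivable : Subset n → Fin n → Set
  Derivable T u = ∃[ a ] (a ∈ T × ∃[ b ] (b ∈ T × ∃[ c ] (c ∈ T × u ≡ (a ∙ b) // c)))

  Derivable-mono : ∀ {S T u} → S ⊆ T → Derivable S u → Derivable T u
  Derivable-mono S⊆T (a , a∈ , b , b∈ , c , c∈ , eq) = a , S⊆T a∈ , b , S⊆T b∈ , c , S⊆T c∈ , eq

  ∈⇒Derivable : ∀ {T u} → u ∈ T → Derivable T u
  ∈⇒Derivable {u = u} u∈T = u , u∈T , u , u∈T , u , u∈T , sym (//-rightDividesʳ u u)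

  -- Sets generated by free and derived elements, and their number

  module Generation (σ : ℕ) where

    -- The indices bound the numbers of free and derived steps from above, as `empty` has any
    -- indices. The size condition in `derived` limits how many triples can be used.
    data Gen : ℕ → ℕ → Subset n → Set where
      empty   : ∀ {e m} → Gen e m ⊥
      free    : ∀ {e m T} → Gen e m T → ∀ v → Gen (suc e) m (T ∪ ⁅ v ⁆)
      derived : ∀ {e m T v} → Gen e m T → ∣ T ∣ ≤ 2 ^ σ → Derivable T v → Gen e (suc m) (T ∪ ⁅ v ⁆)

    Gen-mono : ∀ {e e′ m m′ T} → e ≤ e′ → m ≤ m′ → Gen e m T → Gen e′ m′ T
    Gen-mono e≤       m≤       empty            = empty
    Gen-mono (s≤s e≤) m≤       (free g v)       = free (Gen-mono e≤ m≤ g) v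
    Gen-mono e≤       (s≤s m≤) (derived g T≤ d) = derived (Gen-mono e≤ m≤ g) T≤ d

    FreeStep DerivedStep : ℕ → ℕ → Subset n → Set
    FreeStep    e m U = ∃[ T ] (Gen e m T × ∃[ v ] (v ∈ ⊤ × U ≡ T ∪ ⁅ v ⁆))
    DerivedStep e m U = ∃[ T ] (Gen e m T × ∃[ v ] ((∣ T ∣ ≤ 2 ^ σ × Derivable T v) × U ≡ T ∪ ⁅ v ⁆))

    -- For small `T` there are at most `2 ^ (3 * σ)` triples `a`, `b`, `c`; a larger `T` admits no
    -- derived step at all.
    Few-Derivable : ∀ T → Few (2 ^ (3 * σ)) (λ v → ∣ T ∣ ≤ 2 ^ σ × Derivable T v)
    Few-Derivable T with ∣ T ∣ ≤? 2 ^ σ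
    ... | no  big   = Few-∅ (λ _ small×d → big (proj₁ small×d))
    ... | yes small = Few-⊆ (≤-trans (*-mono-≤ small (*-mono-≤ small small)) (≤-reflexive cube)) (λ _ → proj₂)
      (Few-bind (Few-∈ T) λ a → Few-bind (Few-∈ T) λ b → Few-map (λ c → (a ∙ b) // c) (Few-∈ T))
      where
      cube : 2 ^ σ * (2 ^ σ * 2 ^ σ) ≡ 2 ^ (3 * σ)
      cube = sym (trans (^-distribˡ-+-* 2 σ (σ + (σ + 0))) (cong (2 ^ σ *_)
             (trans (^-distribˡ-+-* 2 σ (σ + 0)) (cong (λ τ → 2 ^ σ * 2 ^ τ) (+-identityʳ σ)))))

    module _ (ℓ : ℕ) (n≤2^ℓ : n ≤ 2 ^ ℓ) where

      -- A free step takes `ℓ` bits and a derived one `3 * σ`. The 2 extra bits per step give the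
      -- factor 4 that absorbs the three alternatives for the last step: none, free or derived.
      cost : ℕ → ℕ → ℕ
      cost e m = e * (ℓ + 2) + m * (3 * σ + 2)

      Few-FreeStep : ∀ {e m N} → Few N (Gen e m) → Few (N * 2 ^ ℓ) (FreeStep e m)
      Few-FreeStep few = Few-bind few λ T → Few-map (λ v → T ∪ ⁅ v ⁆)
        (Few-⊆ (≤-trans (≤-reflexive (∣⊤∣≡n n)) n≤2^ℓ) (λ _ v∈ → v∈) (Few-∈ ⊤))

      Few-DerivedStep : ∀ {e m N} → Few N (Gen e m) → Few (N * 2 ^ (3 * σ)) (DerivedStep e m)
      Few-DerivedStep few = Few-bind few λ T → Few-map (λ v → T ∪ ⁅ v ⁆) (Few-Derivable T)

      private
        Few-step : ∀ {F D : Subset n → Set} {a b x} → 4 ≤ x → 4 * a ≤ x → 4 * b ≤ x → Few a F → Few b D →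
                   Few x (λ U → U ≡ ⊥ ⊎ (F U ⊎ D U))
        Few-step {a = a} {b} 4≤x 4a≤x 4b≤x fewF fewD = Few-⊆ (1+a+b≤x a b 4≤x 4a≤x 4b≤x) (λ _ p → p)
          (Few-⊎ (⊥ ∷ [] , ≤-refl , λ { _ refl → hereₗ refl }) (Few-⊎ fewF fewD))

        4*2^a*2^b : ∀ a b → 4 * (2 ^ a * 2 ^ b) ≡ 2 ^ ((b + 2) + a)
        4*2^a*2^b a b = trans (rearrange (2 ^ a) (2 ^ b))
          (sym (trans (^-distribˡ-+-* 2 (b + 2) a) (cong (_* 2 ^ a) (^-distribˡ-+-* 2 b 2))))
          where
          rearrange : ∀ x y → 4 * (x * y) ≡ y * 4 * x
          rearrange = solve-∀

        free-cost : ∀ e m → 4 * (2 ^ cost e m * 2 ^ ℓ) ≡ 2 ^ cost (suc e) m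
        free-cost e m = trans (4*2^a*2^b (cost e m) ℓ) (cong (2 ^_) (sym (+-assoc (ℓ + 2) (e * (ℓ + 2)) _)))

        derived-cost : ∀ e m → 4 * (2 ^ cost e m * 2 ^ (3 * σ)) ≡ 2 ^ cost e (suc m)
        derived-cost e m = trans (4*2^a*2^b (cost e m) (3 * σ))
          (cong (2 ^_) (rearrange (3 * σ + 2) (e * (ℓ + 2)) (m * (3 * σ + 2))))
          where
          rearrange : ∀ a b c → a + (b + c) ≡ b + (a + c)
          rearrange = solve-∀

        4≤2^cost : ∀ {x a} → 4 * a ≡ x → 1 ≤ a → 4 ≤ x
        4≤2^cost eq 1≤a = ≤-trans (*-monoʳ-≤ 4 1≤a) (≤-reflexive eq)

        1≤2^a*2^b : ∀ a b → 1 ≤ 2 ^ a * 2 ^ b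
        1≤2^a*2^b a b = *-mono-≤ (m^n>0 2 a) (m^n>0 2 b)

      -- Recursion on the last step: the empty set and the results of either kind of step each take
      -- up at most a quarter of the bound.
      Few-Gen : ∀ e m → Few (2 ^ cost e m) (Gen e m)
      Few-Gen zero zero = ⊥ ∷ [] , ≤-refl , λ { _ empty → hereₗ refl }
      Few-Gen (suc e) zero =
        Few-⊆ ≤-refl (λ { _ empty → inj₁ refl ; _ (free g v) → inj₂ (inj₁ (_ , g , v , ∈⊤ , refl)) })
        (Few-step {D = λ _ → Empty} (4≤2^cost (free-cost e 0) (1≤2^a*2^b (cost e 0) ℓ)) (≤-reflexive (free-cost e 0)) z≤n
          (Few-FreeStep (Few-Gen e zero)) (Few-∅ (λ _ ()) {0}))
      Few-Gen zero (suc m) =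
        Few-⊆ ≤-refl (λ { _ empty → inj₁ refl ; _ (derived g T≤ d) → inj₂ (inj₂ (_ , g , _ , (T≤ , d) , refl)) })
        (Few-step {F = λ _ → Empty} (4≤2^cost (derived-cost 0 m) (1≤2^a*2^b (cost 0 m) (3 * σ))) z≤n (≤-reflexive (derived-cost 0 m))
          (Few-∅ (λ _ ()) {0}) (Few-DerivedStep (Few-Gen zero m)))
      Few-Gen (suc e) (suc m) =
        Few-⊆ ≤-refl (λ { _ empty → inj₁ refl ; _ (free g v) → inj₂ (inj₁ (_ , g , v , ∈⊤ , refl))
                        ; _ (derived g T≤ d) → inj₂ (inj₂ (_ , g , _ , (T≤ , d) , refl)) })
        (Few-step (4≤2^cost (free-cost e (suc m)) (1≤2^a*2^b (cost e (suc m)) ℓ)) (≤-reflexive (free-cost e (suc m))) (≤-reflexive (derived-cost (suc e) m))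
          (Few-FreeStep (Few-Gen e (suc m))) (Few-DerivedStep (Few-Gen (suc e) m)))

    -- Growing a generated set inside `A`

    add-derived : ∀ {e} T U → T ⊆ U → Gen e ∣ T ∣ T → (∀ {u} → u ∈ U → Derivable T u) →
                  ∀ j → ∣ T ∣ + j ≤ ∣ U ∣ → ∣ T ∣ + j ≤ 2 ^ σ →
                  ∃[ T′ ] (T ⊆ T′ × T′ ⊆ U × ∣ T′ ∣ ≡ ∣ T ∣ + j × Gen e ∣ T′ ∣ T′)
    add-derived T U T⊆U gen der zero    _  _  = T , (λ x∈ → x∈) , T⊆U , sym (+-identityʳ _) , gen
    add-derived {e} T U T⊆U gen der (suc j) ≤U ≤s
      with add-derived T U T⊆U gen der j (≤-trans (+-monoʳ-≤ ∣ T ∣ (n≤1+n j)) ≤U) (≤-trans (+-monoʳ-≤ ∣ T ∣ (n≤1+n j)) ≤s)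
    ... | T′ , T⊆T′ , T′⊆U , size , gen′
      with ∣p∣<∣q∣⇒∃∈q─p T′ U (≤-trans (≤-reflexive (trans (cong suc size) (sym (+-suc ∣ T ∣ j)))) ≤U)
    ...   | u , u∈U , u∉T′ =
      T′ ∪ ⁅ u ⁆ , (λ x∈ → p⊆p∪q ⁅ u ⁆ (T⊆T′ x∈)) , ∪⁅⁆-⊆ T′⊆U u∈U ,
      trans size′ (trans (cong suc size) (sym (+-suc ∣ T ∣ j))) ,
      subst (λ m → Gen e m (T′ ∪ ⁅ u ⁆)) (sym size′)
        -- `u` is derivable from the initial `T`, hence also from `T′`, whose size is still within
        -- the cap.
        (derived gen′ (≤-trans (≤-reflexive size) (≤-trans (+-monoʳ-≤ ∣ T ∣ (n≤1+n j)) ≤s)) (Derivable-mono T⊆T′ (der u∈U)))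
      where
      size′ : ∣ T′ ∪ ⁅ u ⁆ ∣ ≡ suc ∣ T′ ∣
      size′ = ∣p∪⁅x⁆∣≡1+∣p∣ T′ u∉T′

    -- The budget of derived steps is the size `t` itself, as at most one such step is spent on each
    -- element; only the number `e` of free elements has to be tracked.
    Reach : Subset n → ℕ → ℕ → Set
    Reach A e t = ∃[ T ] (T ⊆ A × ∣ T ∣ ≡ t × Gen e t T)

    Reach-mono : ∀ {A e e′ t} → e ≤ e′ → Reach A e t → Reach A e′ t
    Reach-mono e≤e′ (T , T⊆A , size , gen) = T , T⊆A , size , Gen-mono e≤e′ ≤-refl gen

    -- `v` and `v // d` determine `d`, which together with `u // d` gives `u`; these three elements
    -- lie in `T ∪ ⁅ v ⁆`.
    fibre-derivable : ∀ A T {d u v} → u ∈ fibre A T d → v ∈ fibre A T d → Derivable (T ∪ ⁅ v ⁆) u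
    fibre-derivable A T {d} {u} {v} u∈F v∈F =
      v , q⊆p∪q T ⁅ v ⁆ (x∈⁅x⁆ v) ,
      u // d , p⊆p∪q ⁅ v ⁆ (proj₂ (proj₂ (∈-fibre⁻ A T u∈F))) ,
      v // d , p⊆p∪q ⁅ v ⁆ (proj₂ (proj₂ (∈-fibre⁻ A T v∈F))) , sym (begin
        (v ∙ (u // d)) // (v // d)   ≡⟨ cong ((v ∙ (u // d)) ∙_) (⁻¹-anti-homo-// v d) ⟩
        (v ∙ (u // d)) ∙ (d // v)    ≡⟨ assoc v (u // d) (d // v) ⟩
        v ∙ ((u // d) ∙ (d // v))    ≡⟨ cong (v ∙_) (assoc (u // d) d (v ⁻¹)) ⟨
        v ∙ (((u // d) ∙ d) // v)    ≡⟨ cong (λ w → v ∙ (w // v)) (//-rightDividesˡ d u) ⟩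
        v ∙ (u // v)                 ≡⟨ x∙[y//x]≡y v u ⟩
        u                            ∎)
      where open ≡-Reasoning

    -- At least half of `A` lies outside `T`, so a popular difference has a fibre of size
    -- `f ≥ t / (2 * K)`. One free element of the fibre makes the rest derivable, and stopping early
    -- gives every intermediate size `g`.
    grow : ∀ A K {e t} → ∣ D A ∣ ≤ K * ∣ A ∣ → 0 < t → 2 * t ≤ ∣ A ∣ → Reach A e t →
           ∃[ f ] (t ≤ 2 * K * f × (∀ g → t ≤ g → g ≤ t + f → g ≤ 2 ^ σ → Reach A (suc e) g))
    grow A K {e} {t} small 0<t 2t≤ (T , T⊆A , refl , gen) with popular-difference A T T⊆A
    ... | d , many = f , *-cancelˡ-≤ ∣ A ∣ {{>-nonZero (≤-trans 0<t (≤-trans (m≤m+n _ _) 2t≤))}} (begin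
        ∣ A ∣ * t                   ≤⟨ *-monoˡ-≤ t ∣A∣≤ ⟩
        2 * ∣ A ─ T ∣ * t           ≡⟨ *-assoc 2 ∣ A ─ T ∣ t ⟩
        2 * (∣ A ─ T ∣ * t)         ≤⟨ *-monoʳ-≤ 2 many ⟩
        2 * (f * ∣ D A ∣)           ≤⟨ *-monoʳ-≤ 2 (*-monoʳ-≤ f small) ⟩
        2 * (f * (K * ∣ A ∣))       ≡⟨ rearrange f K ∣ A ∣ ⟩
        ∣ A ∣ * (2 * K * f)         ∎) , reach
      where
      open ≤-Reasoning
      F = fibre A T d
      f = ∣ F ∣
      rearrange : ∀ f K a → 2 * (f * (K * a)) ≡ a * (2 * K * f)
      rearrange = solve-∀
      ∣A∣≤ : ∣ A ∣ ≤ 2 * ∣ A ─ T ∣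
      ∣A∣≤ = +-cancelˡ-≤ ∣ A ∣ _ _ (begin
        ∣ A ∣ + ∣ A ∣                ≡⟨ cong (∣ A ∣ +_) (+-identityʳ ∣ A ∣) ⟨
        2 * ∣ A ∣                    ≡⟨ cong (2 *_) (∣p∩q∣+∣q─p∣≡∣q∣ T A) ⟨
        2 * (∣ T ∩ A ∣ + ∣ A ─ T ∣)  ≤⟨ *-monoʳ-≤ 2 (+-monoˡ-≤ ∣ A ─ T ∣ (∣p∩q∣≤∣p∣ T A)) ⟩
        2 * (t + ∣ A ─ T ∣)          ≡⟨ *-distribˡ-+ 2 t _ ⟩
        2 * t + 2 * ∣ A ─ T ∣        ≤⟨ +-monoˡ-≤ (2 * ∣ A ─ T ∣) 2t≤ ⟩
        ∣ A ∣ + 2 * ∣ A ─ T ∣        ∎)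
      ∣T∪F∣ : ∣ T ∪ F ∣ ≡ t + f
      ∣T∪F∣ = disjoint⇒∣p∪q∣≡∣p∣+∣q∣ T F (λ x∈T x∈F → proj₁ (proj₂ (∈-fibre⁻ A T x∈F)) x∈T)
      T∪F⊆A : T ∪ F ⊆ A
      T∪F⊆A x∈ with x∈p∪q⁻ T F x∈
      ... | inj₁ x∈T = T⊆A x∈T
      ... | inj₂ x∈F = proj₁ (∈-fibre⁻ A T x∈F)
      reach : ∀ g → t ≤ g → g ≤ t + f → g ≤ 2 ^ σ → Reach A (suc e) g
      reach g t≤g g≤ g≤s with m≤n⇒m<n∨m≡n t≤g
      ... | inj₂ refl = T , T⊆A , refl , Gen-mono (n≤1+n e) ≤-refl gen
      ... | inj₁ t<g with ∣p∣<∣q∣⇒∃∈q─p T (T ∪ F) (<-≤-trans t<g (≤-trans g≤ (≤-reflexive (sym ∣T∪F∣))))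
      ...   | v , v∈T∪F , v∉T with x∈p∪q⁻ T F v∈T∪F
      ...     | inj₁ v∈T = contradiction v∈T v∉T
      ...     | inj₂ v∈F
        with add-derived T₁ (T ∪ F) (∪⁅⁆-⊆ (p⊆p∪q F) v∈T∪F)
               -- The free step leaves the derived budget at `t`; it is raised to `suc t` to match
               -- the size of `T₁`.
               (subst (λ m → Gen (suc e) m T₁) (sym ∣T₁∣) (Gen-mono ≤-refl (n≤1+n t) (free gen v)))
               der (g ∸ ∣ T₁ ∣) (≤-trans (≤-reflexive g≡) (≤-trans g≤ (≤-reflexive (sym ∣T∪F∣)))) (≤-trans (≤-reflexive g≡) g≤s)
        where
        T₁ = T ∪ ⁅ v ⁆
        ∣T₁∣ : ∣ T₁ ∣ ≡ suc t
        ∣T₁∣ = ∣p∪⁅x⁆∣≡1+∣p∣ T v∉T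
        g≡ : ∣ T₁ ∣ + (g ∸ ∣ T₁ ∣) ≡ g
        g≡ = m+[n∸m]≡n (≤-trans (≤-reflexive ∣T₁∣) t<g)
        der : ∀ {u} → u ∈ T ∪ F → Derivable T₁ u
        der u∈ with x∈p∪q⁻ T F u∈
        ... | inj₁ u∈T = ∈⇒Derivable (p⊆p∪q ⁅ v ⁆ u∈T)
        ... | inj₂ u∈F = fibre-derivable A T u∈F v∈F
      ...       | T′ , _ , T′⊆ , size , gen′ = T′ , (λ x∈ → T∪F⊆A (T′⊆ x∈)) , size″ , subst (λ m → Gen (suc e) m T′) size″ gen′
        where
        size″ : ∣ T′ ∣ ≡ g
        size″ = trans size (m+[n∸m]≡n (≤-trans (≤-reflexive (∣p∪⁅x⁆∣≡1+∣p∣ T v∉T)) t<g))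

    module _ (A : Subset n) (K : ℕ) (0<K : 0 < K) (small : ∣ D A ∣ ≤ K * ∣ A ∣) where

      -- After `j` rounds either the size is exactly `2 * t` or each round has added at least
      -- `t / (2 * K)` elements. Sizes never exceed `2 * t`, so at least half of `A` stays outside.
      grow* : ∀ {e t} → 0 < t → 4 * t ≤ ∣ A ∣ → 2 * t ≤ 2 ^ σ → Reach A e t → ∀ j →
              ∃[ g ] (Reach A (j + e) g × t ≤ g × g ≤ 2 * t × (j * t + 2 * K * t ≤ 2 * K * g ⊎ g ≡ 2 * t))
      grow* {e} {t} 0<t 4t≤ 2t≤s R zero = t , R , ≤-refl , m≤m+n t _ , inj₁ ≤-refl
      grow* {e} {t} 0<t 4t≤ 2t≤s R (suc j) with grow* 0<t 4t≤ 2t≤s R j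
      ... | g , R′ , t≤g , g≤2t , inj₂ g≡2t = g , Reach-mono (n≤1+n _) R′ , t≤g , g≤2t , inj₂ g≡2t
      ... | g , R′ , t≤g , g≤2t , inj₁ progress
        with grow A K small (≤-trans 0<t t≤g) (≤-trans (*-monoʳ-≤ 2 g≤2t) (≤-trans (≤-reflexive (sym (*-assoc 2 2 t))) 4t≤)) R′
      ...   | f , g≤2Kf , next with g + f ≤? 2 * t
      ...     | yes g+f≤2t = g + f , next (g + f) (m≤m+n g f) ≤-refl (≤-trans g+f≤2t 2t≤s) , ≤-trans t≤g (m≤m+n g f) , g+f≤2t , inj₁ (begin
          suc j * t + 2 * K * t      ≡⟨ +-assoc t (j * t) _ ⟩
          t + (j * t + 2 * K * t)    ≤⟨ +-mono-≤ (≤-trans t≤g g≤2Kf) progress ⟩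
          2 * K * f + 2 * K * g      ≡⟨ +-comm (2 * K * f) _ ⟩
          2 * K * g + 2 * K * f      ≡⟨ *-distribˡ-+ (2 * K) g f ⟨
          2 * K * (g + f)            ∎)
          where open ≤-Reasoning
      -- A round that would overshoot is cut off at exactly `2 * t`.
      ...     | no  g+f≰2t = 2 * t , next (2 * t) g≤2t (<⇒≤ (≰⇒> g+f≰2t)) 2t≤s , m≤m+n t _ , ≤-refl , inj₂ refl

      double : ∀ {e t} → 0 < t → 4 * t ≤ ∣ A ∣ → 2 * t ≤ 2 ^ σ → Reach A e t → Reach A (2 * K + e) (2 * t)
      double {e} {t} 0<t 4t≤ 2t≤s R with grow* 0<t 4t≤ 2t≤s R (2 * K)
      ... | g , R′ , _ , _    , inj₂ refl = R′
      -- After `2 * K` rounds the progress bound reads `2 * K * (2 * t) ≤ 2 * K * g`.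
      ... | g , R′ , _ , g≤2t , inj₁ progress = subst (Reach A (2 * K + e)) (≤-antisym g≤2t 2t≤g) R′
        where
        2t≤g : 2 * t ≤ g
        2t≤g = *-cancelˡ-≤ (2 * K) {{>-nonZero (≤-trans 0<K (m≤m+n K _))}} (≤-trans (≤-reflexive (rearrange (2 * K) t)) progress)
          where
          rearrange : ∀ a t → a * (2 * t) ≡ a * t + a * t
          rearrange = solve-∀

      reach-2^ : 2 * 2 ^ σ ≤ ∣ A ∣ → ∀ i → i ≤ σ → Reach A (i * (2 * K) + 1) (2 ^ i)
      reach-2^ s≤ zero    _ with ∣p∣<∣q∣⇒∃∈q─p ⊥ A (<-≤-trans (s≤s (≤-reflexive (∣⊥∣≡0 n))) (≤-trans (*-mono-≤ (s≤s (z≤n {1})) (m^n>0 2 σ)) s≤))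
      ... | x , x∈A , _ = ⊥ ∪ ⁅ x ⁆ , ∪⁅⁆-⊆ (λ y∈⊥ → contradiction y∈⊥ ∉⊥) x∈A ,
                          trans (∣p∪⁅x⁆∣≡1+∣p∣ {n} ⊥ {x} ∉⊥) (cong suc (∣⊥∣≡0 n)) , free empty x
      reach-2^ s≤ (suc i) i<σ =
        subst (λ e → Reach A e (2 ^ suc i)) (sym (+-assoc (2 * K) (i * (2 * K)) 1))
          (double (m^n>0 2 i)
            (≤-trans (≤-reflexive (*-assoc 2 2 (2 ^ i))) (≤-trans (*-monoʳ-≤ 2 (^-monoʳ-≤ 2 i<σ)) s≤))
            (^-monoʳ-≤ 2 i<σ) (reach-2^ s≤ i (<⇒≤ i<σ)))

    -- Adding an element of A outside X T creates more than ∣ T ∣ / 2 new differences.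
    saturate : ∀ A {e m s} fuel T r → ∣ A ∣ ≤ ∣ T ∣ + fuel → T ⊆ A → s ≤ ∣ T ∣ → Gen (r + e) m T → r * s ≤ 2 * ∣ D T ∣ →
               ∃[ T′ ] ∃[ r′ ] (T′ ⊆ A × s ≤ ∣ T′ ∣ × Gen (r′ + e) m T′ × r′ * s ≤ 2 * ∣ D T′ ∣ × A ⊆ X T′)
    saturate A {s = s} fuel T r size T⊆A s≤ gen rs≤ with any? (λ v → (v ∈? A) ×-dec (suc ∣ T ∣ ≤? 2 * ∣ (v ⊖ T) ─ D T ∣))
    ... | no none = T , r , T⊆A , s≤ , gen , rs≤ , λ {v} v∈A → ∈-comprehension⁺ (mostlyKnown? T) (known v v∈A)
      where
      open ≤-Reasoning
      known : ∀ v → v ∈ A → ∣ T ∣ ≤ 2 * ∣ D T ∩ (v ⊖ T) ∣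
      known v v∈A = +-cancelʳ-≤ ∣ T ∣ _ _ (begin
        ∣ T ∣ + ∣ T ∣                                      ≡⟨ cong (∣ T ∣ +_) (+-identityʳ ∣ T ∣) ⟨
        2 * ∣ T ∣                                          ≡⟨ cong (2 *_) (trans (∣p∩q∣+∣q─p∣≡∣q∣ (D T) (v ⊖ T)) (∣v⊖T∣≡∣T∣ v T)) ⟨
        2 * (∣ D T ∩ (v ⊖ T) ∣ + ∣ (v ⊖ T) ─ D T ∣)        ≡⟨ *-distribˡ-+ 2 ∣ D T ∩ (v ⊖ T) ∣ _ ⟩
        2 * ∣ D T ∩ (v ⊖ T) ∣ + 2 * ∣ (v ⊖ T) ─ D T ∣      ≤⟨ +-monoʳ-≤ _ (≤-pred (≰⇒> (λ good → none (v , v∈A , good)))) ⟩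
        2 * ∣ D T ∩ (v ⊖ T) ∣ + ∣ T ∣                      ∎)
    ... | yes (v , v∈A , good) = continue fuel size
      where
      v∉T : v ∉ T
      -- For `v ∈ T` every `v // t` already lies in `D T`, so no difference would be new.
      v∉T v∈T = contradiction (≤-trans good (*-monoʳ-≤ 2 (≤-trans (p⊆q⇒∣p∣≤∣q∣ {q = ⊥} none) (≤-reflexive (∣⊥∣≡0 n))))) λ ()
        where
        none : (v ⊖ T) ─ D T ⊆ ⊥
        none d∈ = let (d∈⊖ , d∉D) = x∈p─q⇒x∈p×x∉q (v ⊖ T) (D T) d∈ in contradiction (v⊖T⊆D (λ x∈ → x∈) v∈T d∈⊖) d∉D
      T₁ = T ∪ ⁅ v ⁆
      T₁⊆A : T₁ ⊆ A
      T₁⊆A = ∪⁅⁆-⊆ T⊆A v∈A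
      ∣T₁∣ : ∣ T₁ ∣ ≡ suc ∣ T ∣
      ∣T₁∣ = ∣p∪⁅x⁆∣≡1+∣p∣ T v∉T
      gain : suc r * s ≤ 2 * ∣ D T₁ ∣
      gain = begin
        s + r * s                                     ≤⟨ +-mono-≤ (≤-trans s≤ (<⇒≤ good)) rs≤ ⟩
        2 * ∣ (v ⊖ T) ─ D T ∣ + 2 * ∣ D T ∣           ≡⟨ rearrange ∣ (v ⊖ T) ─ D T ∣ ∣ D T ∣ ⟩
        2 * (∣ D T ∣ + ∣ (v ⊖ T) ─ D T ∣)             ≤⟨ *-monoʳ-≤ 2 (D-gain T v) ⟩
        2 * ∣ D T₁ ∣                                  ∎
        where
        open ≤-Reasoning
        rearrange : ∀ a b → 2 * a + 2 * b ≡ 2 * (b + a)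
        rearrange = solve-∀
      continue : ∀ fuel → ∣ A ∣ ≤ ∣ T ∣ + fuel → _
      -- Without fuel `T` is already as large as `A`, which leaves no room for `v`.
      continue zero    size = contradiction (≤-trans (≤-reflexive (sym ∣T₁∣)) (≤-trans (p⊆q⇒∣p∣≤∣q∣ T₁⊆A) (≤-trans size (≤-reflexive (+-identityʳ _))))) 1+n≰n
      continue (suc f) size = saturate A f T₁ (suc r)
        (≤-trans size (≤-reflexive (trans (+-suc ∣ T ∣ f) (cong (_+ f) (sym ∣T₁∣)))))
        T₁⊆A (≤-trans s≤ (≤-trans (n≤1+n _) (≤-reflexive (sym ∣T₁∣)))) (free gen v) gain

-- Choice of parameters

n<2^L : ∀ n → n < 2 ^ L n
n<2^L n = ≰⇒> λ 2^L≤n → 1+n≰n (≤-trans (≤-reflexive (sym (⌊log₂[2^n]⌋≡n (L n)))) (⌊log₂⌋-mono-≤ 2^L≤n))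

power-of-2-above : ∀ ℓ → 0 < ℓ → ∃[ τ ] (ℓ ≤ 2 ^ τ × 2 ^ τ ≤ 2 * ℓ)
power-of-2-above (suc zero)    _ = 0 , ≤-refl , s≤s z≤n
power-of-2-above (suc (suc ℓ)) _ with power-of-2-above (suc ℓ) (s≤s z≤n)
... | τ , ℓ≤ , ≤2ℓ with suc (suc ℓ) ≤? 2 ^ τ
...   | yes ℓ<2^τ = τ , ℓ<2^τ , ≤-trans ≤2ℓ (*-monoʳ-≤ 2 (n≤1+n (suc ℓ)))
...   | no  2^τ≤ℓ = suc τ ,
          ≤-trans (+-mono-≤ (m^n>0 2 τ) ℓ≤) (≤-reflexive (cong (2 ^ τ +_) (sym (+-identityʳ _)))) ,
          *-monoʳ-≤ 2 (<⇒≤ (≰⇒> 2^τ≤ℓ))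

2^τ≤2ℓ⇒τ≤L : ∀ τ ℓ → 0 < ℓ → 2 ^ τ ≤ 2 * ℓ → τ ≤ L ℓ
2^τ≤2ℓ⇒τ≤L τ ℓ 0<ℓ 2^τ≤ = begin
  τ                  ≡⟨ ⌊log₂[2^n]⌋≡n τ ⟨
  ⌊log₂ (2 ^ τ) ⌋    ≤⟨ ⌊log₂⌋-mono-≤ 2^τ≤ ⟩
  ⌊log₂ (2 * ℓ) ⌋    ≡⟨ ⌊log₂[2*b]⌋≡1+⌊log₂b⌋ ℓ {{>-nonZero 0<ℓ}} ⟩
  L ℓ                ∎
  where open ≤-Reasoning

-- Given `(p / q) ^ j ≤ 2`, split `y` into `y / j` blocks of length `j`, each with a factor at most
-- 2, and a remainder that contributes at most one more such factor.
ratio-power : ∀ p q j .{{_ : NonZero q}} .{{_ : NonZero j}} → q ≤ p → p ^ j ≤ 2 * q ^ j →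
              ∀ y → p ^ y ≤ 2 ^ (y / j + 1) * q ^ y
ratio-power p q j q≤p pʲ≤2qʲ y = begin
  p ^ y                                              ≡⟨ cong (p ^_) y≡ ⟩
  p ^ (b + a * j)                                    ≡⟨ ^-distribˡ-+-* p b (a * j) ⟩
  p ^ b * p ^ (a * j)                                ≤⟨ *-mono-≤ remainder (quotient a) ⟩
  2 * q ^ b * (2 ^ a * q ^ (a * j))                  ≡⟨ rearrange (q ^ b) (2 ^ a) (q ^ (a * j)) ⟩
  2 ^ a * 2 * (q ^ b * q ^ (a * j))                  ≡⟨ cong₂ _*_ (^-distribˡ-+-* 2 a 1) (^-distribˡ-+-* q b (a * j)) ⟨
  2 ^ (a + 1) * q ^ (b + a * j)                      ≡⟨ cong (λ z → 2 ^ (a + 1) * q ^ z) y≡ ⟨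
  2 ^ (a + 1) * q ^ y                                ∎
  where
  open ≤-Reasoning
  a = y / j
  b = y % j
  y≡ : y ≡ b + a * j
  y≡ = m≡m%n+[m/n]*n y j
  rearrange : ∀ x y z → 2 * x * (y * z) ≡ y * 2 * (x * z)
  rearrange = solve-∀
  quotient : ∀ a → p ^ (a * j) ≤ 2 ^ a * q ^ (a * j)
  quotient zero    = ≤-refl
  quotient (suc a) = begin
    p ^ (j + a * j)                    ≡⟨ ^-distribˡ-+-* p j (a * j) ⟩
    p ^ j * p ^ (a * j)                ≤⟨ *-mono-≤ pʲ≤2qʲ (quotient a) ⟩
    2 * q ^ j * (2 ^ a * q ^ (a * j))  ≡⟨ rearrange′ (q ^ j) (2 ^ a) (q ^ (a * j)) ⟩
    2 * 2 ^ a * (q ^ j * q ^ (a * j))  ≡⟨ cong (2 * 2 ^ a *_) (^-distribˡ-+-* q j (a * j)) ⟨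
    2 * 2 ^ a * q ^ (j + a * j)        ∎
    where
    rearrange′ : ∀ x y z → 2 * x * (y * z) ≡ 2 * y * (x * z)
    rearrange′ = solve-∀
  remainder : p ^ b ≤ 2 * q ^ b
  -- The remainder is padded to a full block, using `q ≤ p`.
  remainder = *-cancelʳ-≤ _ _ (q ^ (j ∸ b)) {{m^n≢0 q (j ∸ b)}} (begin
    p ^ b * q ^ (j ∸ b)          ≤⟨ *-monoʳ-≤ (p ^ b) (^-monoˡ-≤ (j ∸ b) q≤p) ⟩
    p ^ b * p ^ (j ∸ b)          ≡⟨ ^-distribˡ-+-* p b (j ∸ b) ⟨
    p ^ (b + (j ∸ b))            ≡⟨ cong (p ^_) j≡ ⟩
    p ^ j                        ≤⟨ pʲ≤2qʲ ⟩
    2 * q ^ j                    ≡⟨ cong (λ z → 2 * q ^ z) j≡ ⟨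
    2 * q ^ (b + (j ∸ b))        ≡⟨ cong (2 *_) (^-distribˡ-+-* q b (j ∸ b)) ⟩
    2 * (q ^ b * q ^ (j ∸ b))    ≡⟨ *-assoc 2 (q ^ b) _ ⟨
    2 * q ^ b * q ^ (j ∸ b)      ∎)
    where
    j≡ : b + (j ∸ b) ≡ j
    j≡ = m+[n∸m]≡n (<⇒≤ (m%n<n y j))

-- `(1 + 1/128) ^ 64` is about the square root of e, hence below 2; the inequality is decided by
-- evaluation.
129^y≤ : ∀ y → 129 ^ y ≤ 2 ^ (y / 64 + 1) * 128 ^ y
129^y≤ = ratio-power 129 128 64 (n≤1+n 128) (≤ᵇ⇒≤ (129 ^ 64) (2 * 128 ^ 64) tt)

-- This is `2 * 65536`: the bound `k ≤ 2 * δ` then gives `65536 * q ≤ δ`, which keeps the cost of a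
-- skeleton well below `δ`.
C : ℕ
C = 131072

-- `ℓ` is the number of bits that name a group element, `μ` stands for the logarithm of `ℓ`, and
-- `2 ^ σ` is the size at which growth by popular differences stops.
module Parameters (ℓ μ σ : ℕ) (0<ℓ : 0 < ℓ) (0<μ : 0 < μ)
                  (s-lower : 128 * ℓ ≤ 2 ^ σ) (s-upper : 2 ^ σ ≤ 256 * ℓ) (σ≤ : σ ≤ 8 * μ) where

  s q : ℕ
  s = 2 ^ σ
  q = ℓ * μ

  -- Abstract, because normalising C * q produces 131072 summands.
  abstract
    k : ℕ
    k = C * q

    k≡C*q : k ≡ C * q
    k≡C*q = refl

  instance
    s≢0 : NonZero s
    s≢0 = m^n≢0 2 σ

  0<q : 0 < q
  0<q = *-mono-≤ 0<ℓ 0<μ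

  instance
    k≢0 : NonZero k
    k≢0 = subst NonZero (sym k≡C*q) (m*n≢0 C q {{_}} {{>-nonZero 0<q}})

  ℓ≤q : ℓ ≤ q
  ℓ≤q = ≤-trans (≤-reflexive (sym (*-identityʳ ℓ))) (*-monoʳ-≤ ℓ 0<μ)

  abstract
    2s≤k : 2 * s ≤ k
    2s≤k = begin
      2 * s            ≤⟨ *-monoʳ-≤ 2 (≤-trans s-upper (*-monoʳ-≤ 256 ℓ≤q)) ⟩
      2 * (256 * q)    ≡⟨ *-assoc 2 256 q ⟨
      2 * 256 * q      ≤⟨ *-monoˡ-≤ q (≤ᵇ⇒≤ (2 * 256) C tt) ⟩
      C * q            ∎
      where open ≤-Reasoning

  -- One free element to start, 2K per doubling, and one per s / 2 new differences afterwards.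
  freeElements : ℕ → ℕ → ℕ
  freeElements K δ = (2 * δ) / s + (σ * (2 * K) + 1)

  genCost : ℕ → ℕ → ℕ
  genCost K δ = freeElements K δ * (ℓ + 2) + s * (3 * σ + 2)

  private
    ℓ+2≤3ℓ : ℓ + 2 ≤ 3 * ℓ
    ℓ+2≤3ℓ = +-monoʳ-≤ ℓ (*-monoʳ-≤ 2 0<ℓ)

    -- Each of the `r` elements brings at least `s / 2 ≥ 64 * ℓ` differences and costs at most
    -- `3 * ℓ` bits, which is 3/64 of what it brings.
    saturation-cost : ∀ r δ → r * s ≤ 2 * δ → 64 * (r * (ℓ + 2)) ≤ 3 * δ
    saturation-cost r δ rs≤2δ = *-cancelˡ-≤ 2 (begin
      2 * (64 * (r * (ℓ + 2)))   ≤⟨ *-monoʳ-≤ 2 (*-monoʳ-≤ 64 (*-monoʳ-≤ r ℓ+2≤3ℓ)) ⟩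
      2 * (64 * (r * (3 * ℓ)))   ≡⟨ rearrange r ℓ ⟩
      3 * (r * (128 * ℓ))        ≤⟨ *-monoʳ-≤ 3 (*-monoʳ-≤ r s-lower) ⟩
      3 * (r * s)                ≤⟨ *-monoʳ-≤ 3 rs≤2δ ⟩
      3 * (2 * δ)                ≡⟨ rearrange′ δ ⟩
      2 * (3 * δ)                ∎)
      where
      open ≤-Reasoning
      rearrange : ∀ r ℓ → 2 * (64 * (r * (3 * ℓ))) ≡ 3 * (r * (128 * ℓ))
      rearrange = solve-∀
      rearrange′ : ∀ δ → 3 * (2 * δ) ≡ 2 * (3 * δ)
      rearrange′ = solve-∀

    -- 51 is `3 * (8 * 2 + 1)`: at most `16 * μ * K` elements from the doublings and one to start
    -- with, at no more than `3 * ℓ` bits each.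
    growth-cost : ∀ K → 0 < K → (σ * (2 * K) + 1) * (ℓ + 2) ≤ 51 * (K * q)
    growth-cost K 0<K = begin
      (σ * (2 * K) + 1) * (ℓ + 2)             ≤⟨ *-mono-≤ (+-mono-≤ (*-monoˡ-≤ (2 * K) σ≤) (*-mono-≤ 0<K 0<μ)) ℓ+2≤3ℓ ⟩
      (8 * μ * (2 * K) + K * μ) * (3 * ℓ)     ≡⟨ rearrange K μ ℓ ⟩
      51 * (K * (ℓ * μ))                      ∎
      where
      open ≤-Reasoning
      rearrange : ∀ K μ ℓ → (8 * μ * (2 * K) + K * μ) * (3 * ℓ) ≡ 51 * (K * (ℓ * μ))
      rearrange = solve-∀

    -- 6656 is `256 * 26`, where 26 comes from `3 * σ + 2 ≤ 26 * μ`.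
    derived-cost : s * (3 * σ + 2) ≤ 6656 * q
    derived-cost = begin
      s * (3 * σ + 2)                         ≤⟨ *-mono-≤ s-upper (+-mono-≤ (*-monoʳ-≤ 3 σ≤) (*-monoʳ-≤ 2 0<μ)) ⟩
      256 * ℓ * (3 * (8 * μ) + 2 * μ)         ≡⟨ cong (256 * ℓ *_) (rearrange μ) ⟩
      256 * ℓ * (26 * μ)                      ≡⟨ interchange 256 ℓ 26 μ ⟩
      256 * 26 * (ℓ * μ)                      ∎
      where
      open ≤-Reasoning
      rearrange : ∀ μ → 3 * (8 * μ) + 2 * μ ≡ 26 * μ
      rearrange = solve-∀
      interchange : ∀ a b c d → a * b * (c * d) ≡ a * c * (b * d)
      interchange = solve-∀

  genCost-bound : ∀ K δ → 0 < K → 64 * genCost K δ ≤ 3 * δ + 64 * (51 * (K * q) + 6656 * q)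
  genCost-bound K δ 0<K = begin
    64 * ((r + g) * (ℓ + 2) + d)                      ≡⟨ cong (λ z → 64 * (z + d)) (*-distribʳ-+ (ℓ + 2) r g) ⟩
    64 * (r * (ℓ + 2) + g * (ℓ + 2) + d)              ≡⟨ rearrange 64 (r * (ℓ + 2)) (g * (ℓ + 2)) d ⟩
    64 * (r * (ℓ + 2)) + 64 * (g * (ℓ + 2) + d)       ≤⟨ +-mono-≤ (saturation-cost r δ (m/n*n≤m (2 * δ) s)) (*-monoʳ-≤ 64 (+-mono-≤ (growth-cost K 0<K) derived-cost)) ⟩
    3 * δ + 64 * (51 * (K * q) + 6656 * q)            ∎
    where
    open ≤-Reasoning
    r = (2 * δ) / s
    g = σ * (2 * K) + 1
    d = s * (3 * σ + 2)
    rearrange : ∀ a x y z → a * (x + y + z) ≡ a * x + a * (y + z)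
    rearrange = solve-∀

  private
    scale : ∀ a b c x {y} → a * b ≤ c → c * x ≤ y → a * (b * x) ≤ y
    scale a b c x ab≤c cx≤y = ≤-trans (≤-reflexive (sym (*-assoc a b x))) (≤-trans (*-monoˡ-≤ x ab≤c) cx≤y)

    overhead : 2 * (ℓ + 3) + 1 ≤ 9 * q
    overhead = begin
      2 * (ℓ + 3) + 1     ≤⟨ +-mono-≤ (*-monoʳ-≤ 2 (+-mono-≤ ℓ≤q (*-monoʳ-≤ 3 0<q))) 0<q ⟩
      2 * (q + 3 * q) + q ≡⟨ rearrange q ⟩
      9 * q               ∎
      where
      open ≤-Reasoning
      rearrange : ∀ q → 2 * (q + 3 * q) + q ≡ 9 * q
      rearrange = solve-∀

    -- A description of at most `w / 64` of `δ` bits is affordable, as the overhead takes at most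
    -- another 1/64. The factor 2 pays for identifying elements with their inverses, the final 1 for
    -- the identity, and `ℓ + 3` for the union bound over all indices.
    assemble : ∀ c δ w → 64 * c ≤ w * δ → 2 * w + 1 ≤ 64 → 576 * q ≤ δ → 2 * (c + (ℓ + 3)) + 1 ≤ δ
    assemble c δ w 64c≤ w-small 576q≤ = *-cancelˡ-≤ 64 (begin
      64 * (2 * (c + (ℓ + 3)) + 1)             ≡⟨ rearrange 64 c (ℓ + 3) ⟩
      2 * (64 * c) + 64 * (2 * (ℓ + 3) + 1)    ≤⟨ +-mono-≤ (*-monoʳ-≤ 2 64c≤) (≤-trans (*-monoʳ-≤ 64 overhead) (scale 64 9 576 q ≤-refl 576q≤)) ⟩
      2 * (w * δ) + δ                          ≡⟨ rearrange′ w δ ⟩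
      (2 * w + 1) * δ                          ≤⟨ *-monoˡ-≤ δ w-small ⟩
      64 * δ                                   ∎)
      where
      open ≤-Reasoning
      rearrange : ∀ a c d → a * (2 * (c + d) + 1) ≡ 2 * (a * c) + a * (2 * d + 1)
      rearrange = solve-∀
      rearrange′ : ∀ w δ → 2 * (w * δ) + δ ≡ (2 * w + 1) * δ
      rearrange′ = solve-∀

  -- For `K = 64` the terms in `q` add up to `64 * (51 * 64 + 6656) * q ≤ 10 * δ`; with `3 * δ` for
  -- saturation the cost is 13/64 of `δ`.
  small-doubling-cost : ∀ δ → k ≤ 2 * δ → 2 * (genCost 64 δ + (ℓ + 3)) + 1 ≤ δ
  small-doubling-cost δ k≤2δ = assemble (genCost 64 δ) δ 13 (begin
    64 * genCost 64 δ                              ≤⟨ genCost-bound 64 δ (s≤s z≤n) ⟩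
    3 * δ + 64 * (51 * (64 * q) + 6656 * q)        ≡⟨ cong (λ z → 3 * δ + 64 * (z + 6656 * q)) (*-assoc 51 64 q) ⟨
    3 * δ + 64 * (3264 * q + 6656 * q)             ≡⟨ cong (λ z → 3 * δ + 64 * z) (*-distribʳ-+ q 3264 6656) ⟨
    3 * δ + 64 * (9920 * q)                        ≤⟨ +-monoʳ-≤ (3 * δ) (scale 64 9920 (10 * 65536) q (≤ᵇ⇒≤ (64 * 9920) (10 * 65536) tt)
                                                        (≤-trans (≤-reflexive (*-assoc 10 65536 q)) (*-monoʳ-≤ 10 65536q≤δ))) ⟩
    3 * δ + 10 * δ                                 ≡⟨ *-distribʳ-+ δ 3 10 ⟨
    13 * δ                                         ∎) (≤ᵇ⇒≤ 27 64 tt) (≤-trans (*-monoˡ-≤ q (≤ᵇ⇒≤ 576 65536 tt)) 65536q≤δ)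
    where
    open ≤-Reasoning
    65536q≤δ : 65536 * q ≤ δ
    65536q≤δ = *-cancelˡ-≤ 2 (≤-trans (≤-reflexive (trans (sym (*-assoc 2 65536 q)) (sym k≡C*q))) k≤2δ)

  -- Rounded up, so that `Δ ≤ doubling Δ * k`; a value above 64 still gives `64 * k ≤ Δ`.
  doubling : ℕ → ℕ
  doubling Δ = suc (Δ / k)

  Δ≤doubling*k : ∀ Δ → Δ ≤ doubling Δ * k
  Δ≤doubling*k Δ = ≤-trans (≤-reflexive (m≡m%n+[m/n]*n Δ k)) (+-monoˡ-≤ (Δ / k * k) (<⇒≤ (m%n<n Δ k)))

  -- Bounds the base 2 logarithm of the number of `k`-subsets of a set of size `2 * Δ`, through the
  -- factors `(129 / 128) ^ (2 * Δ)` and `128 ^ k`.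
  subsetCost : ℕ → ℕ
  subsetCost Δ = (2 * Δ) / 64 + 1 + 7 * k

  -- As `k ≤ Δ / 64`, choosing `A` inside `X T` costs at most 10/64 of `Δ`: 2 for the size of `X T`,
  -- 1 for rounding and 7 for the `7 * k` bits. The skeleton costs at most 6/64.
  large-doubling-cost : ∀ Δ → 64 < doubling Δ → 2 * (genCost (doubling Δ) Δ + subsetCost Δ + (ℓ + 3)) + 1 ≤ Δ
  large-doubling-cost Δ 64<K = assemble (genCost K Δ + subsetCost Δ) Δ 16 (begin
    64 * (genCost K Δ + subsetCost Δ)              ≡⟨ *-distribˡ-+ 64 (genCost K Δ) _ ⟩
    64 * genCost K Δ + 64 * subsetCost Δ           ≤⟨ +-mono-≤ gen sub ⟩
    6 * Δ + 10 * Δ                                 ≡⟨ *-distribʳ-+ Δ 6 10 ⟨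
    16 * Δ                                         ∎) (≤ᵇ⇒≤ 33 64 tt) (≤-trans (*-monoˡ-≤ q (≤ᵇ⇒≤ 576 C tt)) (≤-trans (≤-reflexive (sym k≡C*q)) k≤Δ))
    where
    open ≤-Reasoning
    K = doubling Δ
    64k≤Δ : 64 * k ≤ Δ
    64k≤Δ = ≤-trans (*-monoˡ-≤ k (≤-pred 64<K)) (m/n*n≤m Δ k)
    k≤Δ : k ≤ Δ
    k≤Δ = ≤-trans (m≤m+n k _) 64k≤Δ
    K*k≤2Δ : K * k ≤ 2 * Δ
    K*k≤2Δ = ≤-trans (+-mono-≤ k≤Δ (m/n*n≤m Δ k)) (≤-reflexive (cong (Δ +_) (sym (+-identityʳ Δ))))
    C*Kq≤2Δ : C * (K * q) ≤ 2 * Δ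
    C*Kq≤2Δ = ≤-trans (≤-reflexive (trans (rearrange C K q) (cong (K *_) (sym k≡C*q)))) K*k≤2Δ
      where
      rearrange : ∀ a b c → a * (b * c) ≡ b * (a * c)
      rearrange = solve-∀
    gen : 64 * genCost K Δ ≤ 6 * Δ
    gen = begin
      64 * genCost K Δ                                     ≤⟨ genCost-bound K Δ (s≤s z≤n) ⟩
      3 * Δ + 64 * (51 * (K * q) + 6656 * q)               ≡⟨ cong (3 * Δ +_) (*-distribˡ-+ 64 (51 * (K * q)) (6656 * q)) ⟩
      3 * Δ + (64 * (51 * (K * q)) + 64 * (6656 * q))      ≤⟨ +-monoʳ-≤ (3 * Δ) (+-mono-≤
                                                                (scale 64 51 C (K * q) (≤ᵇ⇒≤ (64 * 51) C tt) C*Kq≤2Δ)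
                                                                (scale 64 6656 (64 * C) q (≤ᵇ⇒≤ (64 * 6656) (64 * C) tt) (≤-trans (≤-reflexive (trans (*-assoc 64 C q) (cong (64 *_) (sym k≡C*q)))) 64k≤Δ))) ⟩
      3 * Δ + (2 * Δ + Δ)                                  ≡⟨ rearrange Δ ⟩
      6 * Δ                                                ∎
      where
      rearrange : ∀ x → 3 * x + (2 * x + x) ≡ 6 * x
      rearrange = solve-∀
    sub : 64 * subsetCost Δ ≤ 10 * Δ
    sub = begin
      64 * ((2 * Δ) / 64 + 1 + 7 * k)                      ≡⟨ rearrange₁ 64 ((2 * Δ) / 64) k ⟩
      (2 * Δ) / 64 * 64 + (64 * 1 + 7 * (64 * k))          ≤⟨ +-mono-≤ (m/n*n≤m (2 * Δ) 64) (+-mono-≤ (≤-trans (*-monoʳ-≤ 64 (>-nonZero⁻¹ k)) 64k≤Δ) (*-monoʳ-≤ 7 64k≤Δ)) ⟩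
      2 * Δ + (Δ + 7 * Δ)                                  ≡⟨ rearrange₂ Δ ⟩
      10 * Δ                                               ∎
      where
      rearrange₁ : ∀ a x k → a * (x + 1 + 7 * k) ≡ x * a + (a * 1 + 7 * (a * k))
      rearrange₁ = solve-∀
      rearrange₂ : ∀ x → 2 * x + (x + 7 * x) ≡ 10 * x
      rearrange₂ = solve-∀

-- Certificates

-- The binomial bound with `q = 128`, where `128 ^ k` is `2 ^ (7 * k)`. The size of `Y` is bounded
-- inside the predicate to make the count uniform in `Y`.
Few-sizedSubsets : ∀ {n} (Y : Subset n) (x k : ℕ) →
                   Few (2 ^ (x / 64 + 1 + 7 * k)) (λ A → ∣ Y ∣ ≤ x × A ⊆ Y × ∣ A ∣ ≡ k)
Few-sizedSubsets Y x k with ∣ Y ∣ ≤? x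
... | no  big   = Few-∅ (λ _ p → big (proj₁ p))
... | yes small = sizedSubsets Y k , *-cancelʳ-≤ _ _ (128 ^ ∣ Y ∣) {{m^n≢0 128 ∣ Y ∣}} (begin
    length (sizedSubsets Y k) * 128 ^ ∣ Y ∣                  ≤⟨ length-sizedSubsets 128 Y k ⟩
    129 ^ ∣ Y ∣ * 128 ^ k                                    ≤⟨ *-monoˡ-≤ (128 ^ k) (129^y≤ ∣ Y ∣) ⟩
    2 ^ (∣ Y ∣ / 64 + 1) * 128 ^ ∣ Y ∣ * 128 ^ k             ≤⟨ *-monoˡ-≤ (128 ^ k) (*-monoˡ-≤ (128 ^ ∣ Y ∣) (^-monoʳ-≤ 2 (+-monoˡ-≤ 1 (/-monoˡ-≤ 64 small)))) ⟩
    2 ^ (x / 64 + 1) * 128 ^ ∣ Y ∣ * 128 ^ k                 ≡⟨ rearrange (2 ^ (x / 64 + 1)) (128 ^ ∣ Y ∣) (128 ^ k) ⟩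
    2 ^ (x / 64 + 1) * 128 ^ k * 128 ^ ∣ Y ∣                 ≡⟨ cong (λ z → 2 ^ (x / 64 + 1) * z * 128 ^ ∣ Y ∣) (^-*-assoc 2 7 k) ⟩
    2 ^ (x / 64 + 1) * 2 ^ (7 * k) * 128 ^ ∣ Y ∣             ≡⟨ cong (_* 128 ^ ∣ Y ∣) (^-distribˡ-+-* 2 (x / 64 + 1) (7 * k)) ⟨
    2 ^ (x / 64 + 1 + 7 * k) * 128 ^ ∣ Y ∣                   ∎) ,
    λ { A (_ , A⊆Y , refl) → ∈-sizedSubsets Y A A⊆Y }
  where
  open ≤-Reasoning
  rearrange : ∀ a b c → a * b * c ≡ a * c * b
  rearrange = solve-∀

-- One coordinate for each pair of an element and its inverse

module Representatives {n : ℕ} (G : FinAbGroup n) where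
  open FinAbGroup G
  open Differences G
  open Algebra.Properties.AbelianGroup abelianGroup using (⁻¹-involutive; //-rightDividesʳ; ε⁻¹≈ε; identityˡ-unique)

  -- Of `x` and `x ⁻¹` the one with the smaller index; the random set decides both through this one
  -- coordinate.
  rep : Fin n → Fin n
  rep x with toℕ x ≤? toℕ (x ⁻¹)
  ... | yes _ = x
  ... | no  _ = x ⁻¹

  rep-cases : ∀ x → rep x ≡ x ⊎ rep x ≡ x ⁻¹
  rep-cases x with toℕ x ≤? toℕ (x ⁻¹)
  ... | yes _ = inj₁ refl
  ... | no  _ = inj₂ refl

  rep-⁻¹ : ∀ x → rep (x ⁻¹) ≡ rep x
  rep-⁻¹ x with toℕ (x ⁻¹) ≤? toℕ ((x ⁻¹) ⁻¹) | toℕ x ≤? toℕ (x ⁻¹)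
  ... | yes x⁻¹≤x | yes x≤x⁻¹ = toℕ-injective (≤-antisym (≤-trans x⁻¹≤x (≤-reflexive (cong toℕ (⁻¹-involutive x)))) x≤x⁻¹)
  ... | yes _     | no  _     = refl
  ... | no  _     | yes _     = ⁻¹-involutive x
  ... | no  x⁻¹≰x | no  x≰x⁻¹ =
    contradiction (≤-trans (<⇒≤ (≰⇒> x≰x⁻¹)) (≤-reflexive (cong toℕ (sym (⁻¹-involutive x))))) x⁻¹≰x

  isRep? : ∀ U (y : Fin n) → Dec (∃[ x ] (x ∈ U × ¬ (x ≡ ε) × rep x ≡ y))
  isRep? U y = any? (λ x → (x ∈? U) ×-dec (¬? (x ≟ᶠ ε) ×-dec (rep x ≟ᶠ y)))

  -- The coordinates that decide the elements of `U`. The identity is left out, as it never belongs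
  -- to the connection set.
  reps : Subset n → Subset n
  reps U = ⁅ isRep? U ∣⁆

  reps-mono : ∀ {U V} → U ⊆ V → reps U ⊆ reps V
  reps-mono {U} {V} U⊆V y∈ = let (x , x∈U , p) = ∈-comprehension⁻ (isRep? U) y∈
                             in ∈-comprehension⁺ (isRep? V) (x , U⊆V x∈U , p)

  -- A coordinate decides at most two elements, inverse to each other; the 1 is for the identity.
  ∣U∣≤2∣reps∣+1 : ∀ U → ∣ U ∣ ≤ 2 * ∣ reps U ∣ + 1
  ∣U∣≤2∣reps∣+1 U = begin
    ∣ U ∣                                           ≤⟨ p⊆q⇒∣p∣≤∣q∣ cover ⟩
    ∣ (reps U ∪ preimage _⁻¹ (reps U)) ∪ ⁅ ε ⁆ ∣    ≤⟨ ∣p∪q∣≤∣p∣+∣q∣ (reps U ∪ preimage _⁻¹ (reps U)) ⁅ ε ⁆ ⟩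
    ∣ reps U ∪ preimage _⁻¹ (reps U) ∣ + ∣ ⁅ ε ⁆ ∣  ≤⟨ +-mono-≤ (∣p∪q∣≤∣p∣+∣q∣ (reps U) (preimage _⁻¹ (reps U))) (≤-reflexive (∣⁅x⁆∣≡1 ε)) ⟩
    ∣ reps U ∣ + ∣ preimage _⁻¹ (reps U) ∣ + 1      ≡⟨ cong (λ z → ∣ reps U ∣ + z + 1) (∣preimage∣ (reps U) _⁻¹ _⁻¹ ⁻¹-involutive ⁻¹-involutive) ⟩
    ∣ reps U ∣ + ∣ reps U ∣ + 1                     ≡⟨ cong (λ z → ∣ reps U ∣ + z + 1) (+-identityʳ ∣ reps U ∣) ⟨
    2 * ∣ reps U ∣ + 1                              ∎
    where
    open ≤-Reasoning
    cover : U ⊆ (reps U ∪ preimage _⁻¹ (reps U)) ∪ ⁅ ε ⁆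
    cover {x} x∈U with x ≟ᶠ ε
    ... | yes refl = q⊆p∪q (reps U ∪ preimage _⁻¹ (reps U)) ⁅ ε ⁆ (x∈⁅x⁆ ε)
    ... | no  x≢ε with rep-cases x
    ...   | inj₁ eq = p⊆p∪q ⁅ ε ⁆ (p⊆p∪q (preimage _⁻¹ (reps U)) (∈-comprehension⁺ (isRep? U) (x , x∈U , x≢ε , eq)))
    ...   | inj₂ eq = p⊆p∪q ⁅ ε ⁆ (q⊆p∪q (reps U) (preimage _⁻¹ (reps U)) (∈-preimage⁺ _⁻¹ (reps U) (∈-comprehension⁺ (isRep? U) (x , x∈U , x≢ε , eq))))

  isConnection? : ∀ b (x : Fin n) → Dec (¬ (x ≡ ε) × rep x ∈ b)
  isConnection? b x = ¬? (x ≟ᶠ ε) ×-dec (rep x ∈? b)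

  connectionSet : Subset n → Subset n
  connectionSet b = ⁅ isConnection? b ∣⁆

  connectionSet-symmetric : ∀ b → Symmetric G (connectionSet b)
  connectionSet-symmetric b x x∈ =
    let (x≢ε , rx∈b) = ∈-comprehension⁻ (isConnection? b) x∈
    in ∈-comprehension⁺ (isConnection? b)
         ((λ x⁻¹≡ε → x≢ε (trans (sym (⁻¹-involutive x)) (trans (cong _⁻¹ x⁻¹≡ε) ε⁻¹≈ε))) ,
          subst (_∈ b) (sym (rep-⁻¹ x)) rx∈b)

  connectionSet-zeroFree : ∀ b → ZeroFree G (connectionSet b)
  connectionSet-zeroFree b ε∈ = proj₁ (∈-comprehension⁻ (isConnection? b) ε∈) refl

  -- A difference other than `ε` comes from two distinct elements, and such pairs are what a clique
  -- or an independent set constrains.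
  reps-D : ∀ {A y} → y ∈ reps (D A) →
           ∃[ i ] ∃[ j ] (i ∈ A × j ∈ A × ¬ (i ≡ j) × ¬ (i ∙ (j ⁻¹) ≡ ε) × rep (i ∙ (j ⁻¹)) ≡ y)
  reps-D {A} y∈ with ∈-comprehension⁻ (isRep? (D A)) y∈
  ... | d , d∈D , d≢ε , eq with ∈-D⁻ d∈D
  ...   | x , x∈A , dx∈A = d ∙ x , x , dx∈A , x∈A , (λ dx≡x → d≢ε (identityˡ-unique d x dx≡x)) ,
          (λ e → d≢ε (trans (sym (//-rightDividesʳ x d)) e)) , trans (cong rep (//-rightDividesʳ x d)) eq

  clique⇒reps⊆ : ∀ {b A} → IsClique G (connectionSet b) A → reps (D A) ⊆ b
  clique⇒reps⊆ {b} {A} clique y∈ =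
    let (i , j , i∈A , j∈A , i≢j , _ , eq) = reps-D {A} y∈
    in subst (_∈ b) eq (proj₂ (∈-comprehension⁻ (isConnection? b) (clique i j i∈A j∈A i≢j)))

  independent⇒reps∉ : ∀ {b A} → IsIndependent G (connectionSet b) A → ∀ y → y ∈ reps (D A) → y ∉ b
  independent⇒reps∉ {b} {A} indep y y∈ y∈b =
    let (i , j , i∈A , j∈A , i≢j , ij≢ε , eq) = reps-D {A} y∈
    in indep i j i∈A j∈A i≢j (∈-comprehension⁺ (isConnection? b) (ij≢ε , subst (_∈ b) (sym eq) y∈b))

-- Certificates for all sets of size `k`

module Certificates {n : ℕ} (G : FinAbGroup n) (ℓ μ σ : ℕ) (0<ℓ : 0 < ℓ) (0<μ : 0 < μ)
                    (s-lower : 128 * ℓ ≤ 2 ^ σ) (s-upper : 2 ^ σ ≤ 256 * ℓ) (σ≤ : σ ≤ 8 * μ) (n<2^ℓ : n < 2 ^ ℓ) where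
  open Differences G
  open Generation σ
  open Representatives G
  open Parameters ℓ μ σ 0<ℓ 0<μ s-lower s-upper σ≤

  -- For given `K` the budget depends on `T` only through `∣ D T ∣`, so skeletons can be counted
  -- separately for each value of it.
  Skeleton : Subset n → ℕ → Subset n → Set
  Skeleton A K T = T ⊆ A × 0 < ∣ T ∣ × Gen (freeElements K ∣ D T ∣) s T × A ⊆ X T

  skeleton : ∀ A K → 0 < K → ∣ A ∣ ≡ k → ∣ D A ∣ ≤ K * k → ∃[ T ] Skeleton A K T
  skeleton A K 0<K ∣A∣≡k small
    with reach-2^ A K 0<K (subst (λ m → ∣ D A ∣ ≤ K * m) (sym ∣A∣≡k) small) (subst (2 * s ≤_) (sym ∣A∣≡k) 2s≤k) σ ≤-refl
  ... | T₀ , T₀⊆A , size , gen₀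
    with saturate A {s = s} ∣ A ∣ T₀ 0 (m≤n+m ∣ A ∣ ∣ T₀ ∣) T₀⊆A (≤-reflexive (sym size)) gen₀ z≤n
  ...   | T , r , T⊆A , s≤ , gen , rs≤ , A⊆X =
    T , T⊆A , ≤-trans (m^n>0 2 σ) s≤ , Gen-mono (+-mono-≤ r≤ (≤-reflexive refl)) ≤-refl gen , A⊆X
    where
    r≤ : r ≤ (2 * ∣ D T ∣) / s
    r≤ = ≤-trans (≤-reflexive (sym (m*n/n≡m r s))) (/-monoˡ-≤ s rs≤)

  -- The two kinds of certificates: (false , δ) are the differences of a
  -- skeleton, (true , Δ) those of a k-set found inside X of its skeleton.
  Index : Set
  Index = Bool × ℕ

  Certificate : Index → Subset n → Set
  Certificate (false , δ) U = ∃[ T ] (Gen (freeElements 64 δ) s T × U ≡ reps (D T))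
  Certificate (true  , Δ) U = ∃[ A ] ((∃[ T ] (Gen (freeElements (doubling Δ) Δ) s T × (∣ X T ∣ ≤ 2 * Δ × A ⊆ X T × ∣ A ∣ ≡ k))) ×
                                      U ≡ reps (D A))

  certCost : Index → ℕ
  certCost (false , δ) = genCost 64 δ
  certCost (true  , Δ) = genCost (doubling Δ) Δ + subsetCost Δ

  Few-Certificate : ∀ i → Few (2 ^ certCost i) (Certificate i)
  Few-Certificate (false , δ) = Few-map (reps ∘ D) (Few-Gen ℓ (<⇒≤ n<2^ℓ) (freeElements 64 δ) s)
  Few-Certificate (true  , Δ) =
    Few-⊆ (≤-reflexive (sym (^-distribˡ-+-* 2 (genCost (doubling Δ) Δ) (subsetCost Δ)))) (λ _ p → p)
      (Few-map (reps ∘ D) (Few-bind (Few-Gen ℓ (<⇒≤ n<2^ℓ) (freeElements (doubling Δ) Δ) s)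
                                    (λ T → Few-sizedSubsets (X T) (2 * Δ) k)))

  indicesOf : Bool → List Index
  indicesOf b = map (b ,_) (upTo (suc n))

  indices : List Index
  indices = indicesOf false ++ indicesOf true

  ∈-indices : ∀ b {δ} → δ ≤ n → (b , δ) ∈ₗ indices
  ∈-indices false δ≤n = ∈-++⁺ˡ (∈-map⁺ (false ,_) (∈-upTo⁺ (s≤s δ≤n)))
  ∈-indices true  δ≤n = ∈-++⁺ʳ (indicesOf false) (∈-map⁺ (true ,_) (∈-upTo⁺ (s≤s δ≤n)))

  length-indices : length indices ≤ 2 ^ (ℓ + 1)
  length-indices = begin
    length indices                                        ≡⟨ length-++ (indicesOf false) ⟩
    length (indicesOf false) + length (indicesOf true)    ≡⟨ cong₂ _+_ (length-indicesOf false) (length-indicesOf true) ⟩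
    suc n + suc n                                         ≤⟨ +-mono-≤ n<2^ℓ n<2^ℓ ⟩
    2 ^ ℓ + 2 ^ ℓ                                         ≡⟨ rearrange (2 ^ ℓ) ⟩
    2 ^ ℓ * 2                                             ≡⟨ ^-distribˡ-+-* 2 ℓ 1 ⟨
    2 ^ (ℓ + 1)                                           ∎
    where
    open ≤-Reasoning
    rearrange : ∀ x → x + x ≡ x * 2
    rearrange = solve-∀
    length-indicesOf : ∀ b → length (indicesOf b) ≡ suc n
    length-indicesOf b = trans (length-map (b ,_) (upTo (suc n))) (length-upTo (suc n))

  -- If `b` is nonconstant on a part `U` of `reps (D A)`, then so it is on the whole. The surplus
  -- `ℓ + 1 + 2` is the margin `m + 2` of the union bound for at most `2 ^ (ℓ + 1)` indices.
  Certified : Subset n → Set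
  Certified A = ∃[ i ] ∃[ U ] (i ∈ₗ indices × Certificate i U × certCost i + (ℓ + 1 + 2) ≤ ∣ U ∣ × U ⊆ reps (D A))

  payoff : ∀ c U → 2 * (c + (ℓ + 3)) + 1 ≤ ∣ U ∣ → c + (ℓ + 1 + 2) ≤ ∣ reps U ∣
  payoff c U le = ≤-trans (≤-reflexive (cong (c +_) (+-assoc ℓ 1 2)))
    (*-cancelˡ-≤ 2 (+-cancelʳ-≤ 1 _ _ (≤-trans le (∣U∣≤2∣reps∣+1 U))))

  small-doubling-certified : ∀ A → ∣ A ∣ ≡ k → ∃[ T ] Skeleton A 64 T → Certified A
  small-doubling-certified A ∣A∣≡k (T , T⊆A , 0<∣T∣ , gen , A⊆X) =
    (false , ∣ D T ∣) , reps (D T) , ∈-indices false (∣p∣≤n (D T)) , (T , gen , refl) ,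
    payoff (genCost 64 ∣ D T ∣) (D T) (small-doubling-cost ∣ D T ∣ k≤2δ) , reps-mono {D T} {D A} (D-mono T⊆A)
    where
    k≤2δ : k ≤ 2 * ∣ D T ∣
    k≤2δ = ≤-trans (≤-reflexive (sym ∣A∣≡k)) (≤-trans (p⊆q⇒∣p∣≤∣q∣ A⊆X) (∣X∣≤2∣D∣ T 0<∣T∣))

  large-doubling-certified : ∀ A → ∣ A ∣ ≡ k → 64 < doubling ∣ D A ∣ → ∃[ T ] Skeleton A (doubling ∣ D A ∣) T → Certified A
  large-doubling-certified A ∣A∣≡k 64<K (T , T⊆A , 0<∣T∣ , gen , A⊆X) =
    (true , Δ) , reps (D A) , ∈-indices true (∣p∣≤n (D A)) ,
    -- The budget is raised from `∣ D T ∣` to `Δ`, so that the index records the single number `Δ`.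
    (A , (T , Gen-mono (+-monoˡ-≤ _ (/-monoˡ-≤ s (*-monoʳ-≤ 2 δ≤Δ))) ≤-refl gen ,
          ≤-trans (∣X∣≤2∣D∣ T 0<∣T∣) (*-monoʳ-≤ 2 δ≤Δ) , A⊆X , ∣A∣≡k) , refl) ,
    payoff (genCost (doubling Δ) Δ + subsetCost Δ) (D A) (large-doubling-cost Δ 64<K) , (λ y∈ → y∈)
    where
    Δ = ∣ D A ∣
    δ≤Δ : ∣ D T ∣ ≤ Δ
    δ≤Δ = p⊆q⇒∣p∣≤∣q∣ (D-mono T⊆A)

  certified : ∀ A → ∣ A ∣ ≡ k → Certified A
  certified A ∣A∣≡k = [ small , large ]′ (≤-<-connex (doubling ∣ D A ∣) 64)
    where
    small : doubling ∣ D A ∣ ≤ 64 → Certified A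
    small K≤64 = small-doubling-certified A ∣A∣≡k
      (skeleton A 64 (s≤s z≤n) ∣A∣≡k (≤-trans (Δ≤doubling*k ∣ D A ∣) (*-monoˡ-≤ k K≤64)))
    large : 64 < doubling ∣ D A ∣ → Certified A
    large 64<K = large-doubling-certified A ∣A∣≡k 64<K
      (skeleton A (doubling ∣ D A ∣) (s≤s z≤n) ∣A∣≡k (Δ≤doubling*k ∣ D A ∣))

  Nonconstant : Subset n → Set
  Nonconstant b = ∀ i → i ∈ₗ indices → ∀ U → U ∈ₗ proj₁ (Few-Certificate i) → certCost i + (ℓ + 1 + 2) ≤ ∣ U ∣ →
                  ¬ (U ⊆ b) × ¬ (∀ y → y ∈ U → y ∉ b)

  module _ (b : Subset n) (nonconst : Nonconstant b) where

    nonconstant-on-reps : ∀ A → ∣ A ∣ ≡ k → ¬ (reps (D A) ⊆ b) × ¬ (∀ y → y ∈ reps (D A) → y ∉ b)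
    nonconstant-on-reps A ∣A∣≡k =
      let (i , U , i∈ , cert , big , U⊆) = certified A ∣A∣≡k
          (notIn , notOut) = nonconst i i∈ U (proj₂ (proj₂ (Few-Certificate i)) U cert) big
      in (λ all-in → notIn (λ y∈U → all-in (U⊆ y∈U))) , (λ all-out → notOut (λ y y∈U → all-out y (U⊆ y∈U)))

    clique-bound : ∀ S → IsClique G (connectionSet b) S → ∣ S ∣ ≤ k
    clique-bound S clique = ≮⇒≥ λ k<∣S∣ →
      let (A , A⊆S , ∣A∣≡k) = subset-of-size S k (<⇒≤ k<∣S∣)
      in proj₁ (nonconstant-on-reps A ∣A∣≡k)
           (clique⇒reps⊆ {b} {A} (λ i j i∈A j∈A → clique i j (A⊆S i∈A) (A⊆S j∈A)))

    independent-bound : ∀ S → IsIndependent G (connectionSet b) S → ∣ S ∣ ≤ k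
    independent-bound S indep = ≮⇒≥ λ k<∣S∣ →
      let (A , A⊆S , ∣A∣≡k) = subset-of-size S k (<⇒≤ k<∣S∣)
      in proj₂ (nonconstant-on-reps A ∣A∣≡k)
           (independent⇒reps∉ {b} {A} (λ i j i∈A j∈A → indep i j (A⊆S i∈A) (A⊆S j∈A)))

  ramsey-bound : ∃[ B ] (Symmetric G B × ZeroFree G B ×
                         (∀ S → IsClique G B S → ∣ S ∣ ≤ C * q) × (∀ S → IsIndependent G B S → ∣ S ∣ ≤ C * q))
  ramsey-bound =
    let (b , nonconst) = nonconstant (proj₁ ∘ Few-Certificate) certCost (proj₁ ∘ proj₂ ∘ Few-Certificate)
                                     indices (ℓ + 1) length-indices
    in connectionSet b , connectionSet-symmetric b , connectionSet-zeroFree b ,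
       (λ S clique → ≤-trans (clique-bound b nonconst S clique) (≤-reflexive k≡C*q)) ,
       (λ S indep → ≤-trans (independent-bound b nonconst S indep) (≤-reflexive k≡C*q))

theorem1 : Σ ℕ (λ c → 0 < c × ((n : ℕ) (G : FinAbGroup n) → ∃[ B ] (Symmetric G B × ZeroFree G B × ((S : Subset n) → IsClique G B S → ∣ S ∣ ≤ bound c n) × ((S : Subset n) → IsIndependent G B S → ∣ S ∣ ≤ bound c n))))
theorem1 = C , ≤ᵇ⇒≤ 1 C _ , λ n G →
  let ℓ = L n
      μ = L ℓ
      (τ , ℓ≤2^τ , 2^τ≤2ℓ) = power-of-2-above ℓ (s≤s z≤n)
      2^σ≡ = ^-distribˡ-+-* 2 7 τ
      -- With `σ = 7 + τ` the power `2 ^ σ = 128 * 2 ^ τ` lies between `128 * ℓ` and `256 * ℓ`.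
      (B , sym-B , zf-B , clique , indep) = Certificates.ramsey-bound G ℓ μ (7 + τ) (s≤s z≤n) (s≤s z≤n)
        (≤-trans (*-monoʳ-≤ 128 ℓ≤2^τ) (≤-reflexive (sym 2^σ≡)))
        (≤-trans (≤-reflexive 2^σ≡) (≤-trans (*-monoʳ-≤ 128 2^τ≤2ℓ) (≤-reflexive (sym (*-assoc 128 2 ℓ)))))
        -- `7 + τ ≤ 7 * μ + μ`, from `1 ≤ μ` and `τ ≤ μ`.
        (≤-trans (+-mono-≤ (*-monoʳ-≤ 7 (s≤s (z≤n {⌊log₂ ℓ ⌋}))) (2^τ≤2ℓ⇒τ≤L τ ℓ (s≤s z≤n) 2^τ≤2ℓ)) (≤-reflexive (+-comm (7 * μ) μ)))
        (n<2^L n)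
      k≤bound = *-monoʳ-≤ C (m≤n+m (ℓ * μ) (ω n ^ 3 * L (ω n)))
  in B , sym-B , zf-B , (λ S c → ≤-trans (clique S c) k≤bound) , (λ S c → ≤-trans (indep S c) k≤bound)
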